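{- For all $n,m,l\in\mathbb{N}_0$ with $l\le n$ and $l\le m$, and all $x,y\in[0,1]$, $$\frac{1}{\bigl([x]_q+[1-x]_q\bigr)^{n-l}\bigl([y]_q+[1-y]_q\bigr)^{m-l}}\sum_{k=l}^{n}\sum_{j=l}^{m}\frac{\binom{k}{l}\binom{j}{l}}{\binom{n}{l}\binom{m}{l}}B_{k,j;n,m}(x,y;q)$$ $$=\sum_{k=0}^{l}\sum_{j=0}^{l}q^{\binom{k}{2}+\binom{j}{2}}\binom{x}{k}_q\binom{y}{j}_q[k]_q!\,[j]_q!\,S(l,k;q)\,S(l,j;q).$$
   Context: Fix $q\in(0,1)$. For real $x$ put $[x]_q=\frac{1-q^x}{1-q}$. For $k,j,n,m\in\mathbb{Z}$ and $x,y\in[0,1]$, the modified $q$-Bernstein polynomial of two variables is $B_{k,j;n,m}(x,y;q)=\binom{n}{k}\binom{m}{j}[x]_q^k[y]_q^j[1-x]_q^{n-k}[1-y]_q^{m-j}$ if $0\le k\le n$ and $0\le j\le m$, and $B_{k,j;n,m}(x,y;q)=0$ otherwise. For $k\in\mathbb{N}_0$, $[k]_q!=[1]_q[2]_q\cdots[k]_q$ with $[0]_q!=1$. For real $x$ and $k\in\mathbb{N}_0$, $\binom{x}{k}_q=\frac{[x]_q[x-1]_q\cdots[x-k+1]_q}{[k]_q!}$ (equal to $1$ for $k=0$); for integers $0\le i\le k$, $\binom{k}{i}_q=\frac{[k]_q!}{[i]_q![k-i]_q!}$. The $q$-Stirling numbers of the second kind are $S(n,k;q)=\frac{q^{ -\binom{k}{2}}}{[k]_q!}\sum_{i=0}^{k}(-1)^i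 q^{\binom{i}{2}}\binom{k}{i}_q[k-i]_q^{\,n}$ for $n,k\in\mathbb{N}_0$, with the convention $0^0=1$. -}

module Defs where

open import Algebra.Bundles using (CommutativeRing)
open import Data.Empty using (⊥-elim)
open import Data.Integer.Base as ℤ using (ℤ)
import Data.Integer.Properties as ℤP
open import Data.Nat.Base as ℕ using (ℕ; zero; suc; z≤n; s≤s; _∸_)
open import Data.Nat.Combinatorics using (_C_; nCk+nC[k+1]≡[n+1]C[k+1])
import Data.Nat.Properties as ℕP
open import Data.Product.Base using (∃-syntax; _×_; _,_; proj₁; proj₂)
open import Data.Rational.Base as ℚ using (ℚ; 0ℚ; 1ℚ; ½; ∣_∣; mkℚ)
import Data.Rational.Properties as ℚP
open import Data.Rational.Unnormalised.Base as ℚᵘ using (mkℚᵘ)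
import Data.Rational.Unnormalised.Properties as ℚᵘP
open import Data.Sum.Base using (_⊎_; inj₁; inj₂)
open import Function.Base using (_∘_)
open import Level using (0ℓ)
open import Relation.Binary.PropositionalEquality using (_≡_; _≢_; refl; sym; trans; cong; cong₂; subst; subst₂; module ≡-Reasoning)
open import Relation.Nullary using (yes; no)
open import Relation.Nullary.Decidable using (dec⇒maybe; _×-dec_)
open import Tactic.RingSolver using (solve-∀)
open import Tactic.RingSolver.Core.AlmostCommutativeRing using (AlmostCommutativeRing; fromCommutativeRing)

-- The total reciprocal on ℚ, with 0⁻¹ = 0.
inv : ℚ → ℚ
inv p with p ℚP.≟ 0ℚ
... | yes _   = 0ℚ
... | no  p≢0 = (ℚ.1/ p) {{ℚ.≢-nonZero p≢0}}

ι : ℕ → ℚ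
ι zero    = 0ℚ
ι (suc n) = 1ℚ ℚ.+ ι n

module RationalFacts where
  open import Data.Rational.Base using (_+_; _*_; -_; _-_; _≤_; _<_)

  ℚ-ring : AlmostCommutativeRing _ _
  ℚ-ring = fromCommutativeRing ℚP.+-*-commutativeRing (λ p → dec⇒maybe (0ℚ ℚP.≟ p))

  0≤1 : 0ℚ ≤ 1ℚ
  0≤1 = ℚP.nonNegative⁻¹ 1ℚ

  0<1 : 0ℚ < 1ℚ
  0<1 = ℚP.positive⁻¹ 1ℚ

  0≤-sub : ∀ {a b} → a ≤ b → 0ℚ ≤ b - a
  0≤-sub {a} {b} a≤b = subst (_≤ b - a) (ℚP.+-inverseʳ a) (ℚP.+-monoˡ-≤ (- a) a≤b)

  ≤-by : ∀ {a b} e → 0ℚ ≤ e → a + e ≡ b → a ≤ b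
  ≤-by {a} e 0≤e refl = subst (_≤ a + e) (ℚP.+-identityʳ a) (ℚP.+-monoʳ-≤ a 0≤e)

  0≤+ : ∀ {a b} → 0ℚ ≤ a → 0ℚ ≤ b → 0ℚ ≤ a + b
  0≤+ = ℚP.+-mono-≤

  *-monoL : ∀ {a b} c → 0ℚ ≤ c → a ≤ b → c * a ≤ c * b
  *-monoL c 0≤c = ℚP.*-monoˡ-≤-nonNeg c {{ℚ.nonNegative 0≤c}}

  *-monoR : ∀ {a b} c → 0ℚ ≤ c → a ≤ b → a * c ≤ b * c
  *-monoR c 0≤c = ℚP.*-monoʳ-≤-nonNeg c {{ℚ.nonNegative 0≤c}}

  0≤* : ∀ {a b} → 0ℚ ≤ a → 0ℚ ≤ b → 0ℚ ≤ a * b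
  0≤* {a} {b} 0≤a 0≤b = subst (_≤ a * b) (ℚP.*-zeroʳ a) (*-monoL a 0≤a 0≤b)

  0<* : ∀ {a b} → 0ℚ < a → 0ℚ < b → 0ℚ < a * b
  0<* {a} {b} 0<a 0<b = ℚP.positive⁻¹ (a * b) {{ℚP.pos*pos⇒pos a {{ℚ.positive 0<a}} b {{ℚ.positive 0<b}}}}

  0<+ : ∀ {a b} → 0ℚ < a → 0ℚ < b → 0ℚ < a + b
  0<+ = ℚP.+-mono-<

  *-mono : ∀ {a b c d} → 0ℚ ≤ c → 0ℚ ≤ b → a ≤ b → c ≤ d → a * c ≤ b * d
  *-mono {b = b} {c = c} 0≤c 0≤b a≤b c≤d = ℚP.≤-trans (*-monoR c 0≤c a≤b) (*-monoL b 0≤b c≤d)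

  *-cancelR : ∀ {a b} c → 0ℚ < c → a * c ≤ b * c → a ≤ b
  *-cancelR c 0<c = ℚP.*-cancelʳ-≤-pos c {{ℚ.positive 0<c}}

  half+half : ∀ e → ½ * e + ½ * e ≡ e
  half+half e = trans (sym (ℚP.*-distribʳ-+ e ½ ½)) (ℚP.*-identityˡ e)

  0<½* : ∀ {e} → 0ℚ < e → 0ℚ < ½ * e
  0<½* = 0<* (ℚP.positive⁻¹ ½)

  p≤∣p∣ : ∀ p → p ≤ ∣ p ∣
  p≤∣p∣ p with ℚP.≤-total 0ℚ p
  ... | inj₁ 0≤p = ℚP.≤-reflexive (sym (ℚP.0≤p⇒∣p∣≡p 0≤p))
  ... | inj₂ p≤0 = ℚP.≤-trans p≤0 (ℚP.0≤∣p∣ p)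

  -p≤∣p∣ : ∀ p → - p ≤ ∣ p ∣
  -p≤∣p∣ p = subst (- p ≤_) (ℚP.∣-p∣≡∣p∣ p) (p≤∣p∣ (- p))

  abs≤ : ∀ {p B} → p ≤ B → - p ≤ B → ∣ p ∣ ≤ B
  abs≤ {p} {B} p≤B -p≤B with ℚP.∣p∣≡p∨∣p∣≡-p p
  ... | inj₁ eq = subst (_≤ B) (sym eq) p≤B
  ... | inj₂ eq = subst (_≤ B) (sym eq) -p≤B

  abs-neg-sub : ∀ a b → ∣ a - b ∣ ≡ ∣ b - a ∣
  abs-neg-sub a b = trans (sym (ℚP.∣-p∣≡∣p∣ (a - b))) (cong ∣_∣ (lem a b))
    where
    lem : ∀ a b → - (a - b) ≡ b - a
    lem = solve-∀ ℚ-ring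

  abs-triangle : ∀ {ε δ} a b c → ∣ a - b ∣ ≤ ε → ∣ b - c ∣ ≤ δ → ∣ a - c ∣ ≤ ε + δ
  abs-triangle {ε} {δ} a b c p q = subst (λ z → ∣ z ∣ ≤ ε + δ) (lem a b c)
    (ℚP.≤-trans (ℚP.∣p+q∣≤∣p∣+∣q∣ (a - b) (b - c)) (ℚP.+-mono-≤ p q))
    where
    lem : ∀ a b c → (a - b) + (b - c) ≡ a - c
    lem = solve-∀ ℚ-ring

  abs-+ : ∀ {a b A B} → ∣ a ∣ ≤ A → ∣ b ∣ ≤ B → ∣ a + b ∣ ≤ A + B
  abs-+ {a} {b} p q = ℚP.≤-trans (ℚP.∣p+q∣≤∣p∣+∣q∣ a b) (ℚP.+-mono-≤ p q)

  abs-* : ∀ {a b A B} → ∣ a ∣ ≤ A → ∣ b ∣ ≤ B → ∣ a * b ∣ ≤ A * B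
  abs-* {a} {b} {A} {B} p q = subst (_≤ A * B) (sym (ℚP.∣p*q∣≡∣p∣*∣q∣ a b))
    (*-mono (ℚP.0≤∣p∣ b) (ℚP.≤-trans (ℚP.0≤∣p∣ a) p) p q)

  p*inv : ∀ {p} → p ≢ 0ℚ → p * inv p ≡ 1ℚ
  p*inv {p} p≢0 with p ℚP.≟ 0ℚ
  ... | yes p≡0 = ⊥-elim (p≢0 p≡0)
  ... | no  p≢0 = ℚP.*-inverseʳ p {{ℚ.≢-nonZero p≢0}}

  pos≢0 : ∀ {p} → 0ℚ < p → p ≢ 0ℚ
  pos≢0 0<p p≡0 = ℚP.<⇒≢ 0<p (sym p≡0)

  inv-pos : ∀ {p} → 0ℚ < p → 0ℚ < inv p
  inv-pos {p} 0<p with p ℚP.≟ 0ℚ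
  ... | yes p≡0 = ⊥-elim (pos≢0 0<p p≡0)
  ... | no  p≢0 = ℚP.positive⁻¹ _ {{ℚP.1/pos⇒pos p {{ℚ.positive 0<p}}}}

  ∣inv∣≤ : ∀ {e p} → 0ℚ < e → e ≤ ∣ p ∣ → ∣ inv p ∣ ≤ inv e
  ∣inv∣≤ {e} {p} 0<e e≤∣p∣ = *-cancelR e 0<e (begin
    ∣ inv p ∣ * e      ≤⟨ *-monoL ∣ inv p ∣ (ℚP.0≤∣p∣ _) e≤∣p∣ ⟩
    ∣ inv p ∣ * ∣ p ∣  ≡⟨ ℚP.∣p*q∣≡∣p∣*∣q∣ (inv p) p ⟨
    ∣ inv p * p ∣      ≡⟨ cong ∣_∣ (trans (ℚP.*-comm (inv p) p) (p*inv p≢0)) ⟩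
    1ℚ                 ≡⟨ trans (ℚP.*-comm (inv e) e) (p*inv (pos≢0 0<e)) ⟨
    inv e * e          ∎)
    where
    open ℚP.≤-Reasoning
    p≢0 : p ≢ 0ℚ
    p≢0 refl = ℚP.<-irrefl refl (ℚP.<-≤-trans 0<e e≤∣p∣)

  0≤ι : ∀ n → 0ℚ ≤ ι n
  0≤ι zero    = ℚP.≤-refl
  0≤ι (suc n) = 0≤+ 0≤1 (0≤ι n)

  0<ι : ∀ n → 0ℚ < ι (suc n)
  0<ι n = ℚP.+-mono-<-≤ 0<1 (0≤ι n)

  1≤ι : ∀ n → 1ℚ ≤ ι (suc n)
  1≤ι n = ≤-by (ι n) (0≤ι n) refl

  ι-mono : ∀ {m n} → m ℕ.≤ n → ι m ≤ ι n
  ι-mono {n = n} z≤n = 0≤ι n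
  ι-mono (s≤s m≤n) = ℚP.+-monoʳ-≤ 1ℚ (ι-mono m≤n)

  ι-+ : ∀ m n → ι (m ℕ.+ n) ≡ ι m + ι n
  ι-+ zero    n = sym (ℚP.+-identityˡ _)
  ι-+ (suc m) n = trans (cong (1ℚ +_) (ι-+ m n)) (sym (ℚP.+-assoc 1ℚ (ι m) (ι n)))

  ι-toℚᵘ : ∀ n → ℚ.toℚᵘ (ι n) ℚᵘ.≃ mkℚᵘ (ℤ.+ n) 0
  ι-toℚᵘ zero    = ℚᵘP.≃-refl
  ι-toℚᵘ (suc n) = ℚᵘP.≃-trans (ℚP.toℚᵘ-homo-+ 1ℚ (ι n))
    (ℚᵘP.≃-trans (ℚᵘP.+-congʳ (ℚ.toℚᵘ 1ℚ) (ι-toℚᵘ n)) (ℚᵘ.*≡* eq))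
    where
    eq : (ℤ.+ 1 ℤ.* ℤ.+ 1 ℤ.+ ℤ.+ n ℤ.* ℤ.+ 1) ℤ.* ℤ.+ 1 ≡ ℤ.+ suc n ℤ.* (ℤ.+ 1 ℤ.* ℤ.+ 1)
    eq = trans (ℤP.*-identityʳ _) (trans (cong (λ z → ℤ.+ 1 ℤ.+ z) (ℤP.*-identityʳ (ℤ.+ n))) (sym (ℤP.*-identityʳ _)))

  ≤ι : ∀ p → ∃[ n ] p ≤ ι n
  ≤ι p@(mkℚ (ℤ.+ n) d c) = n , ℚP.toℚᵘ-cancel-≤ (ℚᵘP.≤-respʳ-≃ (ℚᵘP.≃-sym (ι-toℚᵘ n)) (ℚᵘ.*≤* lem))
    where
    lem : ℤ.+ n ℤ.* ℤ.+ 1 ℤ.≤ ℤ.+ n ℤ.* ℤ.+ suc d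
    lem = ℤP.*-monoˡ-≤-nonNeg (ℤ.+ n) (ℤ.+≤+ (s≤s z≤n))
  ≤ι p@(mkℚ ℤ.-[1+ n ] d c) = 0 , ℚP.<⇒≤ (ℚP.negative⁻¹ p)

  archimedean : ∀ a {e} → 0ℚ < e → ∃[ n ] a ≤ ι n * e
  archimedean a {e} 0<e = let n , a/e≤n = ≤ι (a * inv e) in n ,
    subst (_≤ ι n * e) (trans (lem a (inv e) e) (trans (cong (a *_) (p*inv (pos≢0 0<e))) (ℚP.*-identityʳ a)))
      (*-monoR e (ℚP.<⇒≤ 0<e) a/e≤n)
    where
    lem : ∀ a b c → a * b * c ≡ a * (c * b)
    lem = solve-∀ ℚ-ring

Σℚ : ℕ → (ℕ → ℚ) → ℚ
Σℚ zero    f = 0ℚ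
Σℚ (suc n) f = Σℚ n f ℚ.+ f n

-- binomialTerm x s k = x (x - 1) ⋯ (x - k + 1) / k! · sᵏ
binomialTerm : ℚ → ℚ → ℕ → ℚ
binomialTerm x s zero    = 1ℚ
binomialTerm x s (suc k) = binomialTerm x s k ℚ.* ((x ℚ.- ι k) ℚ.* inv (ι (suc k)) ℚ.* s)

module BinomialSeries where
  open import Data.Rational.Base using (_+_; _*_; -_; _-_; _≤_; _<_)
  open RationalFacts

  conv : (ℕ → ℚ) → (ℕ → ℚ) → ℕ → ℚ
  conv f g zero    = f 0 * g 0
  conv f g (suc n) = f 0 * g (suc n) + conv (f ∘ suc) g n

  conv-last : ∀ f g n → conv f g (suc n) ≡ conv f (g ∘ suc) n + f (suc n) * g 0
  conv-last f g zero    = refl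
  conv-last f g (suc n) = trans (cong (f 0 * g (suc (suc n)) +_) (conv-last (f ∘ suc) g n))
    (sym (ℚP.+-assoc (f 0 * g (suc (suc n))) _ _))

  conv-congˡ : ∀ {f f′} g n → (∀ k → f k ≡ f′ k) → conv f g n ≡ conv f′ g n
  conv-congˡ g zero    eq = cong (_* g 0) (eq 0)
  conv-congˡ g (suc n) eq = cong₂ _+_ (cong (_* g (suc n)) (eq 0)) (conv-congˡ g n (eq ∘ suc))

  conv-congʳ : ∀ f {g g′} n → (∀ k → g k ≡ g′ k) → conv f g n ≡ conv f g′ n
  conv-congʳ f zero    eq = cong (f 0 *_) (eq 0)
  conv-congʳ f (suc n) eq = cong₂ _+_ (cong (f 0 *_) (eq (suc n))) (conv-congʳ (f ∘ suc) n eq)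

  θ : (ℕ → ℚ) → ℕ → ℚ
  θ f k = ι k * f k

  D : (ℕ → ℚ) → ℕ → ℚ
  D f k = θ f (suc k)

  conv-linˡ : ∀ a b f h g n → conv (λ k → a * f k + b * h k) g n ≡ a * conv f g n + b * conv h g n
  conv-linˡ a b f h g zero    = lem a b (f 0) (h 0) (g 0)
    where
    lem : ∀ a b f h g → (a * f + b * h) * g ≡ a * (f * g) + b * (h * g)
    lem = solve-∀ ℚ-ring
  conv-linˡ a b f h g (suc n) = trans (cong ((a * f 0 + b * h 0) * g (suc n) +_) (conv-linˡ a b (f ∘ suc) (h ∘ suc) g n))
    (lem a b (f 0) (h 0) (g (suc n)) _ _)
    where
    lem : ∀ a b f h g c d → (a * f + b * h) * g + (a * c + b * d) ≡ a * (f * g + c) + b * (h * g + d)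
    lem = solve-∀ ℚ-ring

  conv-linʳ : ∀ a b f g h n → conv f (λ k → a * g k + b * h k) n ≡ a * conv f g n + b * conv f h n
  conv-linʳ a b f g h zero    = lem a b (f 0) (g 0) (h 0)
    where
    lem : ∀ a b f g h → f * (a * g + b * h) ≡ a * (f * g) + b * (f * h)
    lem = solve-∀ ℚ-ring
  conv-linʳ a b f g h (suc n) = trans (cong (f 0 * (a * g (suc n) + b * h (suc n)) +_) (conv-linʳ a b (f ∘ suc) g h n))
    (lem a b (f 0) (g (suc n)) (h (suc n)) _ _)
    where
    lem : ∀ a b f g h c d → f * (a * g + b * h) + (a * c + b * d) ≡ a * (f * g + c) + b * (f * h + d)
    lem = solve-∀ ℚ-ring

  conv-leibniz : ∀ f g n → ι n * conv f g n ≡ conv (θ f) g n + conv f (θ g) n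
  conv-leibniz f g n = trans (cong (_* conv f g n) (sym (ℚP.+-identityˡ (ι n)))) (go 0 f n)
    where
    go : ∀ j h n → (ι j + ι n) * conv h g n ≡ conv (λ k → ι (j ℕ.+ k) * h k) g n + conv h (θ g) n
    go j h zero rewrite ℕP.+-identityʳ j = lem (ι j) (h 0) (g 0)
      where
      lem : ∀ j h g → (j + 0ℚ) * (h * g) ≡ j * h * g + h * (0ℚ * g)
      lem = solve-∀ ℚ-ring
    go j h (suc n) = trans (lem (ι j) (ι n) (h 0) (g (suc n)) (conv (h ∘ suc) g n))
      (trans (cong (λ z → ι j * h 0 * g (suc n) + h 0 * ((1ℚ + ι n) * g (suc n)) + z)
                (trans (go (suc j) (h ∘ suc) n)
                  (cong (_+ conv (h ∘ suc) (θ g) n)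
                    (conv-congˡ g n (λ k → cong (λ i → ι i * h (suc k)) (sym (ℕP.+-suc j k)))))))
        (trans (cong (λ i → ι i * h 0 * g (suc n) + h 0 * ((1ℚ + ι n) * g (suc n)) + (A + B)) (sym (ℕP.+-identityʳ j)))
          (lem₂ (ι (j ℕ.+ 0) * h 0 * g (suc n)) _ A B)))
      where
      A = conv (λ k → ι (j ℕ.+ suc k) * h (suc k)) g n
      B = conv (h ∘ suc) (θ g) n
      lem : ∀ j n h g c → (j + (1ℚ + n)) * (h * g + c) ≡ j * h * g + h * ((1ℚ + n) * g) + (1ℚ + j + n) * c
      lem = solve-∀ ℚ-ring
      lem₂ : ∀ a b c d → a + b + (c + d) ≡ a + c + (b + d)
      lem₂ = solve-∀ ℚ-ring

  D-term : ∀ x s k → D (binomialTerm x s) k ≡ (s * x) * binomialTerm x s k + - s * θ (binomialTerm x s) k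
  D-term x s k = trans (lem (ι (suc k)) (inv (ι (suc k))) (binomialTerm x s k) x (ι k) s)
    (trans (cong (_* (s * x * t + - s * (ι k * t))) (p*inv (pos≢0 (0<ι k)))) (ℚP.*-identityˡ _))
    where
    t = binomialTerm x s k
    lem : ∀ n i t x k s → n * (t * ((x - k) * i * s)) ≡ n * i * (s * x * t + - s * (k * t))
    lem = solve-∀ ℚ-ring

  D-conv : ∀ f g n → D (conv f g) n ≡ conv (D f) g n + conv f (D g) n
  D-conv f g n = trans (conv-leibniz f g (suc n))
    (trans (cong (conv (θ f) g (suc n) +_) (conv-last f (θ g) n))
      (lem (f 0) (g 0) (g (suc n)) (conv (D f) g n) (conv f (D g) n) (f (suc n))))
    where
    lem : ∀ f₀ g₀ gₙ c d fₙ → 0ℚ * f₀ * gₙ + c + (d + fₙ * (0ℚ * g₀)) ≡ c + d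
    lem = solve-∀ ℚ-ring

  vandermonde : ∀ x y s n → conv (binomialTerm x s) (binomialTerm y s) n ≡ binomialTerm (x + y) s n
  vandermonde x y s zero    = refl
  vandermonde x y s (suc n) = begin
    c (suc n)                                          ≡⟨ ℚP.*-identityʳ _ ⟨
    c (suc n) * 1ℚ                                     ≡⟨ cong (c (suc n) *_) (p*inv (pos≢0 (0<ι n))) ⟨
    c (suc n) * (ι (suc n) * i)                        ≡⟨ lem₁ (c (suc n)) (ι (suc n)) i ⟩
    D c n * i                                          ≡⟨ cong (_* i) Dc ⟩
    (s * (x + y - ι n) * c n) * i                      ≡⟨ lem₂ s (x + y) (ι n) (c n) i ⟩
    c n * ((x + y - ι n) * i * s)                      ≡⟨ cong (_* ((x + y - ι n) * i * s)) (vandermonde x y s n) ⟩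
    binomialTerm (x + y) s (suc n)                     ∎
    where
    open ≡-Reasoning
    t = binomialTerm x s
    u = binomialTerm y s
    c = conv t u
    i = inv (ι (suc n))
    lem₁ : ∀ c n i → c * (n * i) ≡ n * c * i
    lem₁ = solve-∀ ℚ-ring
    lem₂ : ∀ s z n c i → (s * (z - n) * c) * i ≡ c * ((z - n) * i * s)
    lem₂ = solve-∀ ℚ-ring
    lem₃ : ∀ s x y c a b → (s * x * c + - s * a) + (s * y * c + - s * b) ≡ s * ((x + y) * c) - s * (a + b)
    lem₃ = solve-∀ ℚ-ring
    lem₄ : ∀ s z n c → s * (z * c) - s * (n * c) ≡ s * (z - n) * c
    lem₄ = solve-∀ ℚ-ring
    Dc : D c n ≡ s * (x + y - ι n) * c n
    Dc = trans (D-conv t u n) (trans (cong₂ _+_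
           (trans (conv-congˡ u n (D-term x s)) (conv-linˡ (s * x) (- s) t (θ t) u n))
           (trans (conv-congʳ t n (D-term y s)) (conv-linʳ (s * y) (- s) t u (θ u) n)))
         (trans (lem₃ s x y (c n) (conv (θ t) u n) (conv t (θ u) n))
           (trans (cong (λ z → s * ((x + y) * c n) - s * z) (sym (conv-leibniz t u n)))
             (lem₄ s (x + y) (ι n) (c n)))))

Eventually : (ℕ → Set) → Set
Eventually P = ∃[ N ] (∀ n → N ℕ.≤ n → P n)

-- Asymptotic equality. On the diagonal, f ≋ f says that f is a Cauchy sequence,
-- so ≋ is a partial equivalence relation whose domain is the Cauchy sequences.
infix 4 _≋_
record _≋_ (f g : ℕ → ℚ) : Set where
  field
    close : ∀ ε → 0ℚ ℚ.< ε → ∃[ N ] (∀ m n → N ℕ.≤ m → N ℕ.≤ n → ∣ f m ℚ.- g n ∣ ℚ.≤ ε)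

open _≋_ public

module SequenceFacts where
  open import Data.Rational.Base using (_+_; _*_; -_; _-_; _≤_; _<_)
  open RationalFacts

  ev-map : ∀ {P Q : ℕ → Set} → (∀ n → P n → Q n) → Eventually P → Eventually Q
  ev-map f (N , p) = N , λ n N≤n → f n (p n N≤n)

  ev-∧ : ∀ {P Q : ℕ → Set} → Eventually P → Eventually Q → Eventually (λ n → P n × Q n)
  ev-∧ (M , p) (N , q) = M ℕ.⊔ N , λ n h → p n (ℕP.m⊔n≤o⇒m≤o M N h) , q n (ℕP.m⊔n≤o⇒n≤o M N h)

  ev-all : ∀ {P : ℕ → Set} → (∀ n → P n) → Eventually P
  ev-all p = 0 , λ n _ → p n

  ≋-sym : ∀ {f g} → f ≋ g → g ≋ f
  ≋-sym {f} {g} f≋g .close ε 0<ε = let N , p = close f≋g ε 0<ε in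
    N , λ m n N≤m N≤n → subst (_≤ ε) (abs-neg-sub (f n) (g m)) (p n m N≤n N≤m)

  ≋-trans : ∀ {f g h} → f ≋ g → g ≋ h → f ≋ h
  ≋-trans {f} {g} {h} f≋g g≋h .close ε 0<ε =
    let N₁ , p = close f≋g (½ * ε) (0<½* 0<ε)
        N₂ , q = close g≋h (½ * ε) (0<½* 0<ε)
        N = N₁ ℕ.⊔ N₂
    in N , λ m n N≤m N≤n → subst (∣ f m - h n ∣ ≤_) (half+half ε)
             (abs-triangle (f m) (g N) (h n)
               (p m N (ℕP.m⊔n≤o⇒m≤o N₁ N₂ N≤m) (ℕP.m≤m⊔n N₁ N₂))
               (q N n (ℕP.m≤n⊔m N₁ N₂) (ℕP.m⊔n≤o⇒n≤o N₁ N₂ N≤n)))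

  ≋-respʳ : ∀ {f g h} → (∀ n → g n ≡ h n) → f ≋ g → f ≋ h
  ≋-respʳ {f} g≡h f≋g .close ε 0<ε = let N , p = close f≋g ε 0<ε in
    N , λ m n N≤m N≤n → subst (λ z → ∣ f m - z ∣ ≤ ε) (g≡h n) (p m n N≤m N≤n)

  ≋-near : ∀ {f g} → f ≋ f → (∀ ε → 0ℚ < ε → Eventually (λ n → ∣ f n - g n ∣ ≤ ε)) → f ≋ g
  ≋-near {f} {g} f≋f near .close ε 0<ε =
    let N₁ , p = close f≋f (½ * ε) (0<½* 0<ε)
        N₂ , q = near (½ * ε) (0<½* 0<ε)
    in N₁ ℕ.⊔ N₂ , λ m n N≤m N≤n → subst (∣ f m - g n ∣ ≤_) (half+half ε)
             (abs-triangle (f m) (f n) (g n)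
               (p m n (ℕP.m⊔n≤o⇒m≤o N₁ N₂ N≤m) (ℕP.m⊔n≤o⇒m≤o N₁ N₂ N≤n))
               (q n (ℕP.m⊔n≤o⇒n≤o N₁ N₂ N≤n)))

  ≋-const : ∀ p → (λ _ → p) ≋ (λ _ → p)
  ≋-const p .close ε 0<ε = 0 , λ _ _ _ _ → subst (λ z → ∣ z ∣ ≤ ε) (sym (ℚP.+-inverseʳ p)) (ℚP.<⇒≤ 0<ε)

  ≋-+ : ∀ {f f′ g g′} → f ≋ f′ → g ≋ g′ → (λ n → f n + g n) ≋ (λ n → f′ n + g′ n)
  ≋-+ {f} {f′} {g} {g′} f≋f′ g≋g′ .close ε 0<ε =
    let N₁ , p = close f≋f′ (½ * ε) (0<½* 0<ε)
        N₂ , q = close g≋g′ (½ * ε) (0<½* 0<ε)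
    in N₁ ℕ.⊔ N₂ , λ m n N≤m N≤n → subst₂ (λ z e → ∣ z ∣ ≤ e) (lem (f m) (f′ n) (g m) (g′ n)) (half+half ε)
         (abs-+ (p m n (ℕP.m⊔n≤o⇒m≤o N₁ N₂ N≤m) (ℕP.m⊔n≤o⇒m≤o N₁ N₂ N≤n))
                (q m n (ℕP.m⊔n≤o⇒n≤o N₁ N₂ N≤m) (ℕP.m⊔n≤o⇒n≤o N₁ N₂ N≤n)))
    where
    lem : ∀ a b c d → (a - b) + (c - d) ≡ (a + c) - (b + d)
    lem = solve-∀ ℚ-ring

  ≋-neg : ∀ {f f′} → f ≋ f′ → (λ n → - f n) ≋ (λ n → - f′ n)
  ≋-neg {f} {f′} f≋f′ .close ε 0<ε = let N , p = close f≋f′ ε 0<ε in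
    N , λ m n N≤m N≤n → subst (_≤ ε) (trans (sym (ℚP.∣-p∣≡∣p∣ (f m - f′ n))) (cong ∣_∣ (lem (f m) (f′ n)))) (p m n N≤m N≤n)
    where
    lem : ∀ a b → - (a - b) ≡ - a - - b
    lem = solve-∀ ℚ-ring

  ≋-bounded : ∀ {f g} → f ≋ g → ∃[ B ] (0ℚ < B × Eventually (λ n → ∣ f n ∣ ≤ B))
  ≋-bounded {f} {g} f≋g = let N , p = close f≋g 1ℚ 0<1 in
    1ℚ + ∣ g N ∣ , ℚP.+-mono-<-≤ 0<1 (ℚP.0≤∣p∣ (g N)) , N ,
    λ n N≤n → subst (λ z → ∣ z ∣ ≤ 1ℚ + ∣ g N ∣) (lem (f n) (g N)) (abs-+ (p n N N≤n ℕP.≤-refl) ℚP.≤-refl)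
    where
    lem : ∀ a b → a - b + b ≡ a
    lem = solve-∀ ℚ-ring

  inv-cancelʳ : ∀ e {B} → 0ℚ < B → e * inv B * B ≡ e
  inv-cancelʳ e {B} 0<B = trans (lem e (inv B) B) (trans (cong (e *_) (p*inv (pos≢0 0<B))) (ℚP.*-identityʳ e))
    where
    lem : ∀ a b c → a * b * c ≡ a * (c * b)
    lem = solve-∀ ℚ-ring

  ≋-* : ∀ {f f′ g g′} → f ≋ f′ → g ≋ g′ → (λ n → f n * g n) ≋ (λ n → f′ n * g′ n)
  ≋-* {f} {f′} {g} {g′} f≋f′ g≋g′ .close ε 0<ε =
    let F , 0<F , N₃ , bf = ≋-bounded (≋-sym f≋f′)
        G , 0<G , N₄ , bg = ≋-bounded g≋g′
        N₁ , p = close f≋f′ (½ * ε * inv G) (0<* (0<½* 0<ε) (inv-pos 0<G))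
        N₂ , q = close g≋g′ (½ * ε * inv F) (0<* (0<½* 0<ε) (inv-pos 0<F))
        L = N₁ ℕ.⊔ N₂
        R = N₃ ℕ.⊔ N₄
    in L ℕ.⊔ R , λ m n N≤m N≤n →
         let L≤m = ℕP.m⊔n≤o⇒m≤o L R N≤m ; R≤m = ℕP.m⊔n≤o⇒n≤o L R N≤m
             L≤n = ℕP.m⊔n≤o⇒m≤o L R N≤n ; R≤n = ℕP.m⊔n≤o⇒n≤o L R N≤n
         in subst₂ (λ z e → ∣ z ∣ ≤ e) (lem (f m) (f′ n) (g m) (g′ n))
              (trans (cong₂ _+_ (inv-cancelʳ (½ * ε) 0<G) (inv-cancelʳ (½ * ε) 0<F)) (half+half ε))
              (abs-+ (abs-* (p m n (ℕP.m⊔n≤o⇒m≤o N₁ N₂ L≤m) (ℕP.m⊔n≤o⇒m≤o N₁ N₂ L≤n)) (bg m (ℕP.m⊔n≤o⇒n≤o N₃ N₄ R≤m)))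
                     (abs-* (q m n (ℕP.m⊔n≤o⇒n≤o N₁ N₂ L≤m) (ℕP.m⊔n≤o⇒n≤o N₁ N₂ L≤n)) (bf n (ℕP.m⊔n≤o⇒m≤o N₃ N₄ R≤n))))
    where
    lem : ∀ a b c d → (a - b) * c + (c - d) * b ≡ a * c - b * d
    lem = solve-∀ ℚ-ring

  AwayFrom0 : (ℕ → ℚ) → Set
  AwayFrom0 f = ∃[ ε ] (0ℚ < ε × Eventually (λ n → ε ≤ ∣ f n ∣))

  ≋-inv : ∀ {f f′} → AwayFrom0 f → AwayFrom0 f′ → f ≋ f′ → (λ n → inv (f n)) ≋ (λ n → inv (f′ n))
  ≋-inv {f} {f′} (e , 0<e , N₁ , a) (e′ , 0<e′ , N₂ , a′) f≋f′ .close ε 0<ε =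
    let N₃ , p = close f≋f′ (ε * inv I) (0<* 0<ε (inv-pos 0<I))
        L = N₁ ℕ.⊔ N₂
    in L ℕ.⊔ N₃ , λ m n N≤m N≤n →
         let e≤  = a m (ℕP.m⊔n≤o⇒m≤o N₁ N₂ (ℕP.m⊔n≤o⇒m≤o L N₃ N≤m))
             e′≤ = a′ n (ℕP.m⊔n≤o⇒n≤o N₁ N₂ (ℕP.m⊔n≤o⇒m≤o L N₃ N≤n))
         in subst₂ (λ z e → ∣ z ∣ ≤ e) (diff 0<e 0<e′ e≤ e′≤) (inv-cancelʳ ε 0<I)
              (abs-* (subst (_≤ ε * inv I) (abs-neg-sub (f m) (f′ n))
                       (p m n (ℕP.m⊔n≤o⇒n≤o L N₃ N≤m) (ℕP.m⊔n≤o⇒n≤o L N₃ N≤n)))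
                     (abs-* (∣inv∣≤ 0<e e≤) (∣inv∣≤ 0<e′ e′≤)))
    where
    I = inv e * inv e′
    0<I : 0ℚ < I
    0<I = 0<* (inv-pos 0<e) (inv-pos 0<e′)
    away≢0 : ∀ {e p} → 0ℚ < e → e ≤ ∣ p ∣ → p ≢ 0ℚ
    away≢0 0<e e≤ refl = ℚP.<-irrefl refl (ℚP.<-≤-trans 0<e e≤)
    lem : ∀ a b i j → (b - a) * (i * j) ≡ (b * j) * i - (a * i) * j
    lem = solve-∀ ℚ-ring
    lem′ : ∀ i j → 1ℚ * i - 1ℚ * j ≡ i - j
    lem′ = solve-∀ ℚ-ring
    diff : ∀ {e e′ a b} → 0ℚ < e → 0ℚ < e′ → e ≤ ∣ a ∣ → e′ ≤ ∣ b ∣ → (b - a) * (inv a * inv b) ≡ inv a - inv b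
    diff {a = a} {b} 0<e 0<e′ e≤ e′≤ = trans (lem a b (inv a) (inv b))
      (trans (cong₂ (λ u v → u * inv a - v * inv b) (p*inv (away≢0 0<e′ e′≤)) (p*inv (away≢0 0<e e≤))) (lem′ (inv a) (inv b)))

module BinomialSeriesConvergence where
  open import Data.Rational.Base using (_+_; _*_; -_; _-_; _≤_; _<_)
  open RationalFacts
  open BinomialSeries
  open SequenceFacts

  module _ {t a : ℕ → ℚ} (t≤a : ∀ k → ∣ t k ∣ ≤ a k) where

    Σ-tail : ∀ n j → ∣ Σℚ (n ℕ.+ j) t - Σℚ n t ∣ ≤ Σℚ (n ℕ.+ j) a - Σℚ n a
    Σ-tail n zero rewrite ℕP.+-identityʳ n = ℚP.≤-reflexive
      (trans (cong ∣_∣ (ℚP.+-inverseʳ (Σℚ n t))) (sym (ℚP.+-inverseʳ (Σℚ n a))))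
    Σ-tail n (suc j) rewrite ℕP.+-suc n j = subst₂ (λ u v → ∣ u ∣ ≤ v) (lem (Σℚ (n ℕ.+ j) t) (Σℚ n t) (t (n ℕ.+ j))) (lem (Σℚ (n ℕ.+ j) a) (Σℚ n a) (a (n ℕ.+ j)))
      (abs-+ (Σ-tail n j) (t≤a (n ℕ.+ j)))
      where
      lem : ∀ a b c → a - b + c ≡ (a + c) - b
      lem = solve-∀ ℚ-ring

    Σ-tail′ : ∀ {m n} → m ℕ.≤ n → ∣ Σℚ n t - Σℚ m t ∣ ≤ Σℚ n a - Σℚ m a
    Σ-tail′ {m} {n} m≤n = subst (λ k → ∣ Σℚ k t - Σℚ m t ∣ ≤ Σℚ k a - Σℚ m a) (ℕP.m+[n∸m]≡n m≤n) (Σ-tail m (n ℕ.∸ m))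

  Σ-front : ∀ n f → Σℚ (suc n) f ≡ f 0 + Σℚ n (f ∘ suc)
  Σ-front zero    f = ℚP.+-comm 0ℚ (f 0)
  Σ-front (suc n) f = trans (cong (_+ f (suc n)) (Σ-front n f)) (ℚP.+-assoc (f 0) _ _)

  Σ-conv : ∀ n f g → Σℚ (suc n) (conv f g) ≡ f 0 * Σℚ (suc n) g + Σℚ n (conv (f ∘ suc) g)
  Σ-conv zero    f g = lem (f 0) (g 0)
    where
    lem : ∀ a b → 0ℚ + a * b ≡ a * (0ℚ + b) + 0ℚ
    lem = solve-∀ ℚ-ring
  Σ-conv (suc n) f g = trans (cong (_+ conv f g (suc n)) (Σ-conv n f g)) (lem (f 0) (Σℚ (suc n) g) _ (g (suc n)) _)
    where
    lem : ∀ a b c d e → a * b + c + (a * d + e) ≡ a * (b + d) + (c + e)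
    lem = solve-∀ ℚ-ring

  defect : ℕ → ℕ → (ℕ → ℚ) → (ℕ → ℚ) → ℚ
  defect n N f g = Σℚ n f * Σℚ N g - Σℚ n (conv f g)

  defect-suc : ∀ n N f g → defect (suc n) N f g ≡ f 0 * (Σℚ N g - Σℚ (suc n) g) + defect n N (f ∘ suc) g
  defect-suc n N f g = trans (cong₂ (λ u v → u * Σℚ N g - v) (Σ-front n f) (Σ-conv n f g))
    (lem (f 0) (Σℚ n (f ∘ suc)) (Σℚ N g) (Σℚ (suc n) g) (Σℚ n (conv (f ∘ suc) g)))
    where
    lem : ∀ a b c d e → (a + b) * c - (a * d + e) ≡ a * (c - d) + (b * c - e)
    lem = solve-∀ ℚ-ring

  defect-bound : ∀ {f g a b} n N → n ℕ.≤ N → (∀ k → ∣ f k ∣ ≤ a k) → (∀ k → ∣ g k ∣ ≤ b k) →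
                 ∣ defect n N f g ∣ ≤ defect n N a b
  defect-bound {f} {g} {a} {b} zero N _ _ _ = ℚP.≤-reflexive (trans (cong ∣_∣ (lem (Σℚ N g))) (sym (lem (Σℚ N b))))
    where
    lem : ∀ c → 0ℚ * c - 0ℚ ≡ 0ℚ
    lem = solve-∀ ℚ-ring
  defect-bound {f} {g} {a} {b} (suc n) N n<N f≤a g≤b =
    subst₂ (λ u v → ∣ u ∣ ≤ v) (sym (defect-suc n N f g)) (sym (defect-suc n N a b))
      (abs-+ (abs-* (f≤a 0) (Σ-tail′ g≤b n<N))
             (defect-bound n N (ℕP.<⇒≤ n<N) (f≤a ∘ suc) g≤b))

  0≤Σ : ∀ n {a} → (∀ k → 0ℚ ≤ a k) → 0ℚ ≤ Σℚ n a
  0≤Σ zero    _  = ℚP.≤-refl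
  0≤Σ (suc n) 0≤a = 0≤+ (0≤Σ n 0≤a) (0≤a n)

  Σ-mono : ∀ {m n} a → (∀ k → 0ℚ ≤ a k) → m ℕ.≤ n → Σℚ m a ≤ Σℚ n a
  Σ-mono {m} {n} a 0≤a m≤n = ≤-by (Σℚ n a - Σℚ m a)
    (ℚP.≤-trans (ℚP.0≤∣p∣ _) (Σ-tail′ {t = a} {a} (λ k → ℚP.≤-reflexive (ℚP.0≤p⇒∣p∣≡p (0≤a k))) m≤n)) (lem (Σℚ m a) (Σℚ n a))
    where
    lem : ∀ a b → a + (b - a) ≡ b
    lem = solve-∀ ℚ-ring

  0≤conv : ∀ n {a b} → (∀ k → 0ℚ ≤ a k) → (∀ k → 0ℚ ≤ b k) → 0ℚ ≤ conv a b n
  0≤conv zero    0≤a 0≤b = 0≤* (0≤a 0) (0≤b 0)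
  0≤conv (suc n) 0≤a 0≤b = 0≤+ (0≤* (0≤a 0) (0≤b (suc n))) (0≤conv n (0≤a ∘ suc) 0≤b)

  Σ*Σ≤ : ∀ n m {a b} → (∀ k → 0ℚ ≤ a k) → (∀ k → 0ℚ ≤ b k) → Σℚ n a * Σℚ m b ≤ Σℚ (n ℕ.+ m) (conv a b)
  Σ*Σ≤ zero    m {a} {b} 0≤a 0≤b = subst (_≤ Σℚ m (conv a b)) (sym (ℚP.*-zeroˡ (Σℚ m b))) (0≤Σ m (λ k → 0≤conv k 0≤a 0≤b))
  Σ*Σ≤ (suc n) m {a} {b} 0≤a 0≤b = subst₂ _≤_
    (trans (sym (ℚP.*-distribʳ-+ (Σℚ m b) (a 0) (Σℚ n (a ∘ suc)))) (cong (_* Σℚ m b) (sym (Σ-front n a))))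
    (sym (Σ-conv (n ℕ.+ m) a b))
    (ℚP.+-mono-≤ (*-monoL (a 0) (0≤a 0) (Σ-mono b 0≤b (ℕP.m≤n⇒m≤1+n (ℕP.m≤n+m m n)))) (Σ*Σ≤ n m (0≤a ∘ suc) 0≤b))

  -- a convergent majorant, uniform in ∣ x ∣ ≤ M and ∣ s ∣ ≤ 1 - 2d

  majorant : ℚ → ℚ → ℕ → ℚ
  majorant M d zero    = 1ℚ
  majorant M d (suc k) = majorant M d k * ((M + ι k) * inv (ι (suc k)) * (1ℚ - d - d))

  term≤majorant : ∀ {x s M d} → ∣ x ∣ ≤ M → ∣ s ∣ ≤ 1ℚ - d - d → ∀ k → ∣ binomialTerm x s k ∣ ≤ majorant M d k
  term≤majorant x≤M s≤ρ zero    = ℚP.≤-refl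
  term≤majorant {x} x≤M s≤ρ (suc k) = abs-* (term≤majorant x≤M s≤ρ k)
    (abs-* (abs-* (abs-+ {a = x} {b = - ι k} x≤M (ℚP.≤-reflexive (trans (ℚP.∣-p∣≡∣p∣ (ι k)) (ℚP.0≤p⇒∣p∣≡p (0≤ι k)))))
                  (ℚP.≤-reflexive (ℚP.0≤p⇒∣p∣≡p (ℚP.<⇒≤ (inv-pos (0<ι k))))))
           s≤ρ)

  module Majorant {M d : ℚ} (0≤M : 0ℚ ≤ M) (0<d : 0ℚ < d) (0≤ρ : 0ℚ ≤ 1ℚ - d - d) where
    a : ℕ → ℚ
    a = majorant M d

    A : ℕ → ℚ
    A n = Σℚ n a

    0≤d : 0ℚ ≤ d
    0≤d = ℚP.<⇒≤ 0<d

    0≤a : ∀ k → 0ℚ ≤ a k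
    0≤a zero    = 0≤1
    0≤a (suc k) = 0≤* (0≤a k) (0≤* (0≤* (0≤+ 0≤M (0≤ι k)) (ℚP.<⇒≤ (inv-pos (0<ι k)))) 0≤ρ)

    ratio : ∀ k → M ≤ ι k * d → a (suc k) ≤ a k * (1ℚ - d)
    ratio k M≤kd = *-monoL (a k) (0≤a k) (*-cancelR (ι (suc k)) (0<ι k) (subst (_≤ (1ℚ - d) * ι (suc k)) eq ineq))
      where
      lem : ∀ m i r n → m * r * (n * i) ≡ m * i * r * n
      lem = solve-∀ ℚ-ring
      eq : (M + ι k) * (1ℚ - d - d) ≡ (M + ι k) * inv (ι (suc k)) * (1ℚ - d - d) * ι (suc k)
      eq = trans (trans (sym (ℚP.*-identityʳ _)) (cong ((M + ι k) * (1ℚ - d - d) *_) (sym (p*inv (pos≢0 (0<ι k))))))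
             (lem (M + ι k) (inv (ι (suc k))) (1ℚ - d - d) (ι (suc k)))
      lem₂ : ∀ M d k → (M + k) * (1ℚ - d - d) + (((1ℚ - d - d) + d) + (k * d - M) + (d * M + d * M)) ≡ (1ℚ - d) * (1ℚ + k)
      lem₂ = solve-∀ ℚ-ring
      ineq : (M + ι k) * (1ℚ - d - d) ≤ (1ℚ - d) * ι (suc k)
      ineq = ≤-by _ (0≤+ (0≤+ (0≤+ 0≤ρ 0≤d) (0≤-sub M≤kd)) (0≤+ (0≤* 0≤d 0≤M) (0≤* 0≤d 0≤M))) (lem₂ M d (ι k))

    module _ (K : ℕ) (M≤Kd : M ≤ ι K * d) where
      ratio′ : ∀ n → a (suc (K ℕ.+ n)) ≤ a (K ℕ.+ n) * (1ℚ - d)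
      ratio′ n = ratio (K ℕ.+ n) (ℚP.≤-trans M≤Kd (*-monoR d 0≤d (ι-mono (ℕP.m≤m+n K n))))

      bernoulli : ∀ n → a (K ℕ.+ n) * (1ℚ + ι n * d) ≤ a K
      bernoulli zero rewrite ℕP.+-identityʳ K = ℚP.≤-reflexive (lem (a K) d)
        where
        lem : ∀ a d → a * (1ℚ + 0ℚ * d) ≡ a
        lem = solve-∀ ℚ-ring
      bernoulli (suc n) rewrite ℕP.+-suc K n = begin
        a (suc (K ℕ.+ n)) * (1ℚ + ι (suc n) * d)         ≤⟨ *-monoR _ (0≤+ 0≤1 (0≤* (0≤ι (suc n)) 0≤d)) (ratio′ n) ⟩
        a (K ℕ.+ n) * (1ℚ - d) * (1ℚ + ι (suc n) * d)    ≤⟨ ≤-by _ (0≤* (0≤a (K ℕ.+ n)) (0≤* (0≤ι (suc n)) (0≤* 0≤d 0≤d))) (lem (a (K ℕ.+ n)) d (ι n)) ⟩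
        a (K ℕ.+ n) * (1ℚ + ι n * d)                     ≤⟨ bernoulli n ⟩
        a K                                              ∎
        where
        open ℚP.≤-Reasoning
        lem : ∀ a d n → a * (1ℚ - d) * (1ℚ + (1ℚ + n) * d) + a * ((1ℚ + n) * (d * d)) ≡ a * (1ℚ + n * d)
        lem = solve-∀ ℚ-ring

      tail : ∀ n j → d * (A (K ℕ.+ n ℕ.+ j) - A (K ℕ.+ n)) ≤ a (K ℕ.+ n) - a (K ℕ.+ n ℕ.+ j)
      tail n zero rewrite ℕP.+-identityʳ (K ℕ.+ n) = ℚP.≤-reflexive (lem d (A (K ℕ.+ n)) (a (K ℕ.+ n)))
        where
        lem : ∀ d x y → d * (x - x) ≡ y - y
        lem = solve-∀ ℚ-ring
      tail n (suc j) rewrite ℕP.+-suc (K ℕ.+ n) j = begin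
        d * (A (suc k) - A (K ℕ.+ n))                        ≡⟨ lem d (A k) (a k) (A (K ℕ.+ n)) ⟩
        d * (A k - A (K ℕ.+ n)) + d * a k                    ≤⟨ ℚP.+-mono-≤ (tail n j) (≤-by _ (0≤-sub r) (lem₂ d (a k) (a (suc k)))) ⟩
        (a (K ℕ.+ n) - a k) + (a k - a (suc k))              ≡⟨ lem₃ (a (K ℕ.+ n)) (a k) (a (suc k)) ⟩
        a (K ℕ.+ n) - a (suc k)                              ∎
        where
        open ℚP.≤-Reasoning
        k = K ℕ.+ n ℕ.+ j
        r : a (suc k) ≤ a k * (1ℚ - d)
        r = ratio k (ℚP.≤-trans M≤Kd (*-monoR d 0≤d (ι-mono (ℕP.≤-trans (ℕP.m≤m+n K n) (ℕP.m≤m+n (K ℕ.+ n) j)))))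
        lem : ∀ d x y z → d * (x + y - z) ≡ d * (x - z) + d * y
        lem = solve-∀ ℚ-ring
        lem₂ : ∀ d x y → d * x + (x * (1ℚ - d) - y) ≡ x - y
        lem₂ = solve-∀ ℚ-ring
        lem₃ : ∀ x y z → (x - y) + (y - z) ≡ x - z
        lem₃ = solve-∀ ℚ-ring

    A-tail : ∀ ε → 0ℚ < ε → ∃[ N ] (∀ m → N ℕ.≤ m → A m - A N ≤ ε)
    A-tail ε 0<ε =
      let K , M≤Kd = archimedean M 0<d
          n , aK≤  = archimedean (a K) (0<* (0<* 0<d 0<d) 0<ε)
      in K ℕ.+ n , λ m N≤m → *-cancelR (d * (1ℚ + ι n * d)) (0<* 0<d (ℚP.+-mono-<-≤ 0<1 (0≤* (0≤ι n) 0≤d))) (begin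
        (A m - A (K ℕ.+ n)) * (d * (1ℚ + ι n * d))         ≡⟨ lem₁ (A m - A (K ℕ.+ n)) d (1ℚ + ι n * d) ⟩
        (d * (A m - A (K ℕ.+ n))) * (1ℚ + ι n * d)         ≤⟨ *-monoR _ (0≤+ 0≤1 (0≤* (0≤ι n) 0≤d))
              (subst (λ m → d * (A m - A (K ℕ.+ n)) ≤ a (K ℕ.+ n) - a m) (ℕP.m+[n∸m]≡n N≤m) (tail K M≤Kd n (m ℕ.∸ (K ℕ.+ n)))) ⟩
        (a (K ℕ.+ n) - a m) * (1ℚ + ι n * d)               ≤⟨ *-monoR _ (0≤+ 0≤1 (0≤* (0≤ι n) 0≤d)) (≤-by {a (K ℕ.+ n) - a m} (a m) (0≤a m) (lem₂ (a (K ℕ.+ n)) (a m))) ⟩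
        a (K ℕ.+ n) * (1ℚ + ι n * d)                       ≤⟨ bernoulli K M≤Kd n ⟩
        a K                                                ≤⟨ aK≤ ⟩
        ι n * (d * d * ε)                                  ≤⟨ ≤-by _ (0≤* 0≤d (ℚP.<⇒≤ 0<ε)) (lem₃ (ι n) d ε) ⟩
        ε * (d * (1ℚ + ι n * d))                           ∎)
      where
      open ℚP.≤-Reasoning
      lem₁ : ∀ x d w → x * (d * w) ≡ (d * x) * w
      lem₁ = solve-∀ ℚ-ring
      lem₂ : ∀ x y → x - y + y ≡ x
      lem₂ = solve-∀ ℚ-ring
      lem₃ : ∀ n d e → n * (d * d * e) + d * e ≡ e * (d * (1ℚ + n * d))
      lem₃ = solve-∀ ℚ-ring

    A-cauchy : A ≋ A
    A-cauchy .close ε 0<ε = let N , p = A-tail ε 0<ε in N , λ m n N≤m N≤n →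
      abs≤ (ℚP.≤-trans (≤-by (A n - A N) (0≤-sub (Σ-mono a 0≤a N≤n)) (lem (A m) (A n) (A N))) (p m N≤m))
           (ℚP.≤-trans (≤-by (A m - A N) (0≤-sub (Σ-mono a 0≤a N≤m)) (lem′ (A m) (A n) (A N))) (p n N≤n))
      where
      lem : ∀ m n k → m - n + (n - k) ≡ m - k
      lem = solve-∀ ℚ-ring
      lem′ : ∀ m n k → - (m - n) + (m - k) ≡ n - k
      lem′ = solve-∀ ℚ-ring

  binomialSum : ℕ → ℚ → ℚ → ℚ
  binomialSum n x s = Σℚ n (binomialTerm x s)

  term-≋ : ∀ {f f′ s s′} k → f ≋ f′ → s ≋ s′ → (λ n → binomialTerm (f n) (s n) k) ≋ (λ n → binomialTerm (f′ n) (s′ n) k)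
  term-≋ zero    f≋f′ s≋s′ = ≋-const 1ℚ
  term-≋ (suc k) f≋f′ s≋s′ = ≋-* (term-≋ k f≋f′ s≋s′) (≋-* (≋-* (≋-+ f≋f′ (≋-const (- ι k))) (≋-const (inv (ι (suc k))))) s≋s′)

  S-≋ : ∀ {f f′ s s′} N → f ≋ f′ → s ≋ s′ → (λ n → binomialSum N (f n) (s n)) ≋ (λ n → binomialSum N (f′ n) (s′ n))
  S-≋ zero    f≋f′ s≋s′ = ≋-const 0ℚ
  S-≋ (suc N) f≋f′ s≋s′ = ≋-+ (S-≋ N f≋f′ s≋s′) (term-≋ N f≋f′ s≋s′)

  -- ∣ s n ∣ is eventually bounded away from 1
  Ratio : (ℕ → ℚ) → ℚ → Set
  Ratio s d = Eventually (λ n → ∣ s n ∣ ≤ 1ℚ - d - d)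

  Ratio⇒0≤ρ : ∀ {s d} → Ratio s d → 0ℚ ≤ 1ℚ - d - d
  Ratio⇒0≤ρ (N , p) = ℚP.≤-trans (ℚP.0≤∣p∣ _) (p N ℕP.≤-refl)

  series-≋ : ∀ {f f′ s s′ d} → 0ℚ < d → Ratio s d → Ratio s′ d → f ≋ f′ → s ≋ s′ →
             (λ n → binomialSum n (f n) (s n)) ≋ (λ n → binomialSum n (f′ n) (s′ n))
  series-≋ {f} {f′} {s} {s′} {d} 0<d (N₁ , r) (N₂ , r′) f≋f′ s≋s′ .close ε 0<ε =
    let F  , 0<F  , N₃ , bf  = ≋-bounded f≋f′
        F′ , 0<F′ , N₄ , bf′ = ≋-bounded (≋-sym f≋f′)
        M = F + F′
        0≤ρ = Ratio⇒0≤ρ {s} {d} (N₁ , r)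
        open Majorant {M} {d} (0≤+ (ℚP.<⇒≤ 0<F) (ℚP.<⇒≤ 0<F′)) 0<d 0≤ρ
        K  , at = A-tail (½ * (½ * ε)) (0<½* (0<½* 0<ε))
        N₅ , mid = close (S-≋ K f≋f′ s≋s′) (½ * ε) (0<½* 0<ε)
        N = K ℕ.+ (N₁ ℕ.+ N₂ ℕ.+ (N₃ ℕ.+ N₄ ℕ.+ N₅))
        l = N₁ ℕ.+ N₂
        h = N₃ ℕ.+ N₄
        K≤ = ℕP.m+n≤o⇒m≤o K {l ℕ.+ (h ℕ.+ N₅)}
        lh≤ = ℕP.m+n≤o⇒n≤o K {l ℕ.+ (h ℕ.+ N₅)}
        l≤ = λ {m} (p : N ℕ.≤ m) → ℕP.m+n≤o⇒m≤o l {h ℕ.+ N₅} (lh≤ p)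
        h5≤ = λ {m} (p : N ℕ.≤ m) → ℕP.m+n≤o⇒n≤o l {h ℕ.+ N₅} (lh≤ p)
        h≤ = λ {m} (p : N ℕ.≤ m) → ℕP.m+n≤o⇒m≤o h {N₅} (h5≤ p)
        N₅≤ = λ {m} (p : N ℕ.≤ m) → ℕP.m+n≤o⇒n≤o h {N₅} (h5≤ p)
        tl = λ m (p : N ℕ.≤ m) → ℚP.≤-trans
               (Σ-tail′ (term≤majorant {x = f m} {s m} {M} {d}
                  (ℚP.≤-trans (bf m (ℕP.m+n≤o⇒m≤o N₃ (h≤ p))) (≤-by F′ (ℚP.<⇒≤ 0<F′) refl))
                  (r m (ℕP.m+n≤o⇒m≤o N₁ (l≤ p)))) (K≤ p)) (at m (K≤ p))
        tl′ = λ m (p : N ℕ.≤ m) → ℚP.≤-trans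
               (Σ-tail′ (term≤majorant {x = f′ m} {s′ m} {M} {d}
                  (ℚP.≤-trans (bf′ m (ℕP.m+n≤o⇒n≤o N₃ (h≤ p))) (≤-by F (ℚP.<⇒≤ 0<F) (ℚP.+-comm F′ F)))
                  (r′ m (ℕP.m+n≤o⇒n≤o N₁ (l≤ p)))) (K≤ p)) (at m (K≤ p))
    in N , λ m n N≤m N≤n → subst (∣ binomialSum m (f m) (s m) - binomialSum n (f′ n) (s′ n) ∣ ≤_) quarter
         (abs-triangle (binomialSum m (f m) (s m)) (binomialSum K (f′ n) (s′ n)) (binomialSum n (f′ n) (s′ n))
           (abs-triangle (binomialSum m (f m) (s m)) (binomialSum K (f m) (s m)) (binomialSum K (f′ n) (s′ n)) (tl m N≤m) (mid m n (N₅≤ N≤m) (N₅≤ N≤n)))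
           (subst (_≤ ½ * (½ * ε)) (abs-neg-sub (binomialSum n (f′ n) (s′ n)) (binomialSum K (f′ n) (s′ n))) (tl′ n N≤n)))
    where
    lem : ∀ a b → a + b + a ≡ a + a + b
    lem = solve-∀ ℚ-ring
    quarter : ½ * (½ * ε) + ½ * ε + ½ * (½ * ε) ≡ ε
    quarter = trans (lem (½ * (½ * ε)) (½ * ε)) (trans (cong (_+ ½ * ε) (half+half (½ * ε))) (half+half ε))

  series-homo : ∀ {f g s d} → 0ℚ < d → Ratio s d → f ≋ f → g ≋ g → s ≋ s →
                (λ n → binomialSum n (f n) (s n) * binomialSum n (g n) (s n)) ≋ (λ n → binomialSum n (f n + g n) (s n))
  series-homo {f} {g} {s} {d} 0<d rat@(N₁ , r) f≋f g≋g s≋s = ≋-near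
    (≋-* (series-≋ 0<d rat rat f≋f s≋s) (series-≋ 0<d rat rat g≋g s≋s)) λ ε 0<ε →
    let F , 0<F , N₃ , bf = ≋-bounded f≋f
        G , 0<G , N₄ , bg = ≋-bounded g≋g
        M = F + G
        0≤ρ = Ratio⇒0≤ρ {s} {d} rat
        open Majorant {M} {d} (0≤+ (ℚP.<⇒≤ 0<F) (ℚP.<⇒≤ 0<G)) 0<d 0≤ρ
        K , A²≤ = close (≋-* A-cauchy A-cauchy) ε 0<ε
        N = (K ℕ.+ K) ℕ.+ (N₁ ℕ.+ (N₃ ℕ.+ N₄))
    in N , λ n N≤n →
       let K+K≤n = ℕP.m+n≤o⇒m≤o (K ℕ.+ K) N≤n
           rest = ℕP.m+n≤o⇒n≤o (K ℕ.+ K) N≤n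
           N₁≤n = ℕP.m+n≤o⇒m≤o N₁ rest
           rest′ = ℕP.m+n≤o⇒n≤o N₁ rest
           t = binomialTerm (f n) (s n)
           u = binomialTerm (g n) (s n)
           t≤a = term≤majorant {x = f n} {s n} {M} {d}
                  (ℚP.≤-trans (bf n (ℕP.m+n≤o⇒m≤o N₃ rest′)) (≤-by G (ℚP.<⇒≤ 0<G) refl)) (r n N₁≤n)
           u≤a = term≤majorant {x = g n} {s n} {M} {d}
                  (ℚP.≤-trans (bg n (ℕP.m+n≤o⇒n≤o N₃ rest′)) (≤-by F (ℚP.<⇒≤ 0<F) (ℚP.+-comm G F))) (r n N₁≤n)
       in subst (λ z → ∣ Σℚ n t * Σℚ n u - z ∣ ≤ ε) (Σ-cong n (vandermonde (f n) (g n) (s n)))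
            (ℚP.≤-trans (defect-bound n n ℕP.≤-refl t≤a u≤a)
              (ℚP.≤-trans (≤-by (Σℚ n (conv a a) - A K * A K) (0≤-sub (ℚP.≤-trans (Σ*Σ≤ K K 0≤a 0≤a)
                                     (Σ-mono (conv a a) (λ k → 0≤conv k 0≤a 0≤a) K+K≤n)))
                             (lem (A n * A n) (Σℚ n (conv a a)) (A K * A K)))
                (ℚP.≤-trans (p≤∣p∣ (A n * A n - A K * A K)) (A²≤ n K (ℕP.≤-trans (ℕP.m≤m+n K K) K+K≤n) ℕP.≤-refl))))
    where
    lem : ∀ x y z → x - y + (y - z) ≡ x - z
    lem = solve-∀ ℚ-ring
    Σ-cong : ∀ n {h h′} → (∀ k → h k ≡ h′ k) → Σℚ n h ≡ Σℚ n h′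
    Σ-cong zero    eq = refl
    Σ-cong (suc n) eq = cong₂ _+_ (Σ-cong n eq) (eq n)

open RationalFacts
open SequenceFacts
open BinomialSeriesConvergence

-- ≋ compares sequences at independent indices, hence cauchy below is the usual
-- Cauchy condition; real numbers are identified along _≈_.
record ℝ : Set where
  no-eta-equality
  field
    seq    : ℕ → ℚ
    cauchy : seq ≋ seq

open ℝ public

infix  4 _≈_ _<_ _≤_ _#_
infixl 6 _+_ _-_
infixl 7 _*_
infix  8 -_

record _≈_ (x y : ℝ) : Set where
  constructor mk≈
  field
    seq-≋ : seq x ≋ seq y

open _≈_ public

record _<_ (x y : ℝ) : Set where
  constructor mk<
  field
    gap : ∃[ ε ] (0ℚ ℚ.< ε × Eventually (λ n → seq x n ℚ.+ ε ℚ.≤ seq y n))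

open _<_ public

record _≤_ (x y : ℝ) : Set where
  constructor mk≤
  field
    almost : ∀ ε → 0ℚ ℚ.< ε → Eventually (λ n → seq x n ℚ.≤ seq y n ℚ.+ ε)

open _≤_ public

_#_ : ℝ → ℝ → Set
x # y = x < y ⊎ y < x

fromℚ : ℚ → ℝ
seq    (fromℚ p) = λ _ → p
cauchy (fromℚ p) = ≋-const p

0ℝ 1ℝ : ℝ
0ℝ = fromℚ 0ℚ
1ℝ = fromℚ 1ℚ

fromℕ : ℕ → ℝ
fromℕ n = fromℚ (ι n)

_+_ : ℝ → ℝ → ℝ
seq    (x + y) = λ n → seq x n ℚ.+ seq y n
cauchy (x + y) = ≋-+ (cauchy x) (cauchy y)

_*_ : ℝ → ℝ → ℝ
seq    (x * y) = λ n → seq x n ℚ.* seq y n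
cauchy (x * y) = ≋-* (cauchy x) (cauchy y)

-_ : ℝ → ℝ
seq    (- x) = λ n → ℚ.- seq x n
cauchy (- x) = ≋-neg (cauchy x)

_-_ : ℝ → ℝ → ℝ
x - y = x + (- y)

#0⇒away : ∀ {x} → x # 0ℝ → AwayFrom0 (seq x)
#0⇒away {x} (inj₁ (mk< (ε , 0<ε , ev))) = ε , 0<ε , ev-map (λ n p → ℚP.≤-trans
  (≤-by _ (0≤-sub p) (lem (seq x n) ε)) (-p≤∣p∣ (seq x n))) ev
  where
  lem : ∀ x e → e ℚ.+ (0ℚ ℚ.- (x ℚ.+ e)) ≡ ℚ.- x
  lem = solve-∀ ℚ-ring
#0⇒away {x} (inj₂ (mk< (ε , 0<ε , ev))) = ε , 0<ε , ev-map (λ n p → ℚP.≤-trans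
  (subst (ℚ._≤ seq x n) (ℚP.+-identityˡ ε) p) (p≤∣p∣ (seq x n))) ev

recip : (x : ℝ) → x # 0ℝ → ℝ
seq    (recip x x#0) = λ n → inv (seq x n)
cauchy (recip x x#0) = ≋-inv (#0⇒away x#0) (#0⇒away x#0) (cauchy x)

infixl 7 _÷_[_]
_÷_[_] : (x y : ℝ) → y # 0ℝ → ℝ
x ÷ y [ y#0 ] = x * recip y y#0

pointwise : ∀ {x y} → (∀ n → seq x n ≡ seq y n) → x ≈ y
pointwise {x} eq = mk≈ (≋-respʳ eq (cauchy x))

ℝ-commutativeRing : CommutativeRing 0ℓ 0ℓ
ℝ-commutativeRing = record
  { Carrier = ℝ ; _≈_ = _≈_ ; _+_ = _+_ ; _*_ = _*_ ; -_ = -_ ; 0# = 0ℝ ; 1# = 1ℝ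
  ; isCommutativeRing = record
    { isRing = record
      { +-isAbelianGroup = record
        { isGroup = record
          { isMonoid = record
            { isSemigroup = record
              { isMagma = record
                { isEquivalence = record
                  { refl  = λ {x} → mk≈ (cauchy x)
                  ; sym   = λ p → mk≈ (≋-sym (seq-≋ p))
                  ; trans = λ p q → mk≈ (≋-trans (seq-≋ p) (seq-≋ q))
                  }
                ; ∙-cong = λ p q → mk≈ (≋-+ (seq-≋ p) (seq-≋ q))
                }
              ; assoc = λ x y z → pointwise λ n → ℚP.+-assoc (seq x n) (seq y n) (seq z n)
              }
            ; identity = (λ x → pointwise λ n → ℚP.+-identityˡ (seq x n)) , (λ x → pointwise λ n → ℚP.+-identityʳ (seq x n))
            }
          ; inverse = (λ x → pointwise λ n → ℚP.+-inverseˡ (seq x n)) , (λ x → pointwise λ n → ℚP.+-inverseʳ (seq x n))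
          ; ⁻¹-cong = λ p → mk≈ (≋-neg (seq-≋ p))
          }
        ; comm = λ x y → pointwise λ n → ℚP.+-comm (seq x n) (seq y n)
        }
      ; *-cong = λ p q → mk≈ (≋-* (seq-≋ p) (seq-≋ q))
      ; *-assoc = λ x y z → pointwise λ n → ℚP.*-assoc (seq x n) (seq y n) (seq z n)
      ; *-identity = (λ x → pointwise λ n → ℚP.*-identityˡ (seq x n)) , (λ x → pointwise λ n → ℚP.*-identityʳ (seq x n))
      ; distrib = (λ x y z → pointwise λ n → ℚP.*-distribˡ-+ (seq x n) (seq y n) (seq z n))
                , (λ x y z → pointwise λ n → ℚP.*-distribʳ-+ (seq x n) (seq y n) (seq z n))
      }
    ; *-comm = λ x y → pointwise λ n → ℚP.*-comm (seq x n) (seq y n)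
    }
  }

private module R = CommutativeRing ℝ-commutativeRing

open import Algebra.Properties.Semiring.Exp R.semiring public using (_^_)

recip-inverse : ∀ x (x#0 : x # 0ℝ) → x * recip x x#0 ≈ 1ℝ
recip-inverse x x#0 = let ε , 0<ε , N , away = #0⇒away x#0 in
  mk≈ (≋-near (cauchy (x * recip x x#0)) λ δ 0<δ → N , λ n N≤n →
    subst (λ z → ∣ z ℚ.- 1ℚ ∣ ℚ.≤ δ) (sym (p*inv (λ eq → ℚP.<-irrefl refl (ℚP.<-≤-trans 0<ε
      (subst (λ z → ε ℚ.≤ ∣ z ∣) eq (away n N≤n)))))) (ℚP.<⇒≤ 0<δ))

0<-resp-≈ : ∀ {x y} → x ≈ y → 0ℝ < x → 0ℝ < y
0<-resp-≈ {x} {y} (mk≈ x≋y) (mk< (ε , 0<ε , N₁ , p)) =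
  let N₂ , c = close x≋y (½ ℚ.* ε) (0<½* 0<ε) in
  mk< (½ ℚ.* ε , 0<½* 0<ε , N₁ ℕ.⊔ N₂ , λ n N≤n →
    let pₙ = p n (ℕP.m⊔n≤o⇒m≤o N₁ N₂ N≤n)
        cₙ = c n n (ℕP.m⊔n≤o⇒n≤o N₁ N₂ N≤n) (ℕP.m⊔n≤o⇒n≤o N₁ N₂ N≤n)
        h = ½ ℚ.* ε
    in ≤-by _ (0≤+ (0≤-sub pₙ) (0≤-sub (ℚP.≤-trans (p≤∣p∣ (seq x n ℚ.- seq y n)) cₙ)))
         (trans (cong (λ e → 0ℚ ℚ.+ h ℚ.+ ((seq x n ℚ.- (0ℚ ℚ.+ e)) ℚ.+ (h ℚ.- (seq x n ℚ.- seq y n)))) (sym (half+half ε)))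
                (lem h (seq x n) (seq y n))))
  where
  lem : ∀ h x y → 0ℚ ℚ.+ h ℚ.+ ((x ℚ.- (0ℚ ℚ.+ (h ℚ.+ h))) ℚ.+ (h ℚ.- (x ℚ.- y))) ≡ y
  lem = solve-∀ ℚ-ring

0<-intro : ∀ {x} ε → 0ℚ ℚ.< ε → Eventually (λ n → ε ℚ.≤ seq x n) → 0ℝ < x
0<-intro {x} ε 0<ε ev = mk< (ε , 0<ε , ev-map (λ n → subst (ℚ._≤ seq x n) (sym (ℚP.+-identityˡ ε))) ev)

0<-elim : ∀ {x} → 0ℝ < x → ∃[ ε ] (0ℚ ℚ.< ε × Eventually (λ n → ε ℚ.≤ seq x n))
0<-elim {x} (mk< (ε , 0<ε , ev)) = ε , 0<ε , ev-map (λ n → subst (ℚ._≤ seq x n) (ℚP.+-identityˡ ε)) ev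

0<1ℝ : 0ℝ < 1ℝ
0<1ℝ = 0<-intro 1ℚ 0<1 (ev-all λ _ → ℚP.≤-refl)

0<-* : ∀ {x y} → 0ℝ < x → 0ℝ < y → 0ℝ < x * y
0<-* {x} {y} 0<x 0<y =
  let ε , 0<ε , p = 0<-elim 0<x
      δ , 0<δ , q = 0<-elim 0<y
  in 0<-intro (ε ℚ.* δ) (0<* 0<ε 0<δ) (ev-map (λ n (a , b) →
       *-mono (ℚP.<⇒≤ 0<δ) (ℚP.≤-trans (ℚP.<⇒≤ 0<ε) a) a b) (ev-∧ p q))

0<-^ : ∀ {x} n → 0ℝ < x → 0ℝ < x ^ n
0<-^ zero    0<x = 0<1ℝ
0<-^ (suc n) 0<x = 0<-* 0<x (0<-^ n 0<x)

0<-recip : ∀ {x} (x#0 : x # 0ℝ) → 0ℝ < x → 0ℝ < recip x x#0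
0<-recip {x} x#0 0<x =
  let ε , 0<ε , p = 0<-elim 0<x
      B , 0<B , b = ≋-bounded (cauchy x)
  in 0<-intro (inv B) (inv-pos 0<B) (ev-map (λ n (ε≤x , x≤B) →
       let 0<xₙ = ℚP.<-≤-trans 0<ε ε≤x in
       *-cancelR (seq x n) 0<xₙ (subst (inv B ℚ.* seq x n ℚ.≤_)
         (trans (trans (ℚP.*-comm (inv B) B) (p*inv (pos≢0 0<B))) (sym (trans (ℚP.*-comm (inv (seq x n)) (seq x n)) (p*inv (pos≢0 0<xₙ)))))
         (*-monoL (inv B) (ℚP.<⇒≤ (inv-pos 0<B)) (ℚP.≤-trans (p≤∣p∣ (seq x n)) x≤B)))) (ev-∧ p b))

<⇒0<- : ∀ {x y} → x < y → 0ℝ < y - x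
<⇒0<- {x} {y} (mk< (ε , 0<ε , ev)) = 0<-intro ε 0<ε (ev-map (λ n p → ≤-by _ (0≤-sub p) (lem (seq x n) (seq y n) ε)) ev)
  where
  lem : ∀ x y e → e ℚ.+ (y ℚ.- (x ℚ.+ e)) ≡ y ℚ.- x
  lem = solve-∀ ℚ-ring

>0⇒#0 : ∀ {x} → 0ℝ < x → x # 0ℝ
>0⇒#0 = inj₂

fromℕ-0< : ∀ {n} → 1 ℕ.≤ n → 0ℝ < fromℕ n
fromℕ-0< {suc n} _ = 0<-intro 1ℚ 0<1 (ev-all λ _ → 1≤ι n)

C-pos : ∀ {n k} → k ℕ.≤ n → 1 ℕ.≤ n C k
C-pos {n} z≤n = ℕP.≤-refl
C-pos {suc n} {suc k} (s≤s k≤n) = subst (1 ℕ.≤_) (nCk+nC[k+1]≡[n+1]C[k+1] n k) (ℕP.≤-trans (C-pos k≤n) (ℕP.m≤m+n (n C k) _))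

module UnitInterval where
  clamp : ℚ → ℚ
  clamp p = 0ℚ ℚ.⊔ (p ℚ.⊓ 1ℚ)

  0≤clamp : ∀ p → 0ℚ ℚ.≤ clamp p
  0≤clamp p = ℚP.p≤p⊔q 0ℚ (p ℚ.⊓ 1ℚ)

  clamp≤1 : ∀ p → clamp p ℚ.≤ 1ℚ
  clamp≤1 p = ℚP.⊔-lub 0≤1 (ℚP.p⊓q≤q p 1ℚ)

  clamp-near : ∀ {p ε} → 0ℚ ℚ.≤ ε → 0ℚ ℚ.≤ p ℚ.+ ε → p ℚ.≤ 1ℚ ℚ.+ ε → ∣ p ℚ.- clamp p ∣ ℚ.≤ ε
  clamp-near {p} {ε} 0≤ε lo hi with ℚP.≤-total p 1ℚ
  ... | inj₂ 1≤p rewrite ℚP.p≥q⇒p⊓q≡q 1≤p = abs≤ (≤-by _ (0≤-sub hi) (lem p ε)) (≤-by _ (0≤+ (0≤-sub 1≤p) 0≤ε) (lem₂ p ε))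
    where
    lem : ∀ p e → p ℚ.- 1ℚ ℚ.+ ((1ℚ ℚ.+ e) ℚ.- p) ≡ e
    lem = solve-∀ ℚ-ring
    lem₂ : ∀ p e → ℚ.- (p ℚ.- 1ℚ) ℚ.+ ((p ℚ.- 1ℚ) ℚ.+ e) ≡ e
    lem₂ = solve-∀ ℚ-ring
  ... | inj₁ p≤1 rewrite ℚP.p≤q⇒p⊓q≡p p≤1 with ℚP.≤-total 0ℚ p
  ...   | inj₁ 0≤p rewrite ℚP.p≤q⇒p⊔q≡q 0≤p = subst (λ z → ∣ z ∣ ℚ.≤ ε) (sym (ℚP.+-inverseʳ p)) 0≤ε
  ...   | inj₂ p≤0 rewrite ℚP.p≥q⇒p⊔q≡p p≤0 = abs≤ (≤-by _ (0≤+ (0≤-sub p≤0) 0≤ε) (lem p ε)) (≤-by _ lo (lem₂ p ε))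
    where
    lem : ∀ p e → p ℚ.- 0ℚ ℚ.+ ((0ℚ ℚ.- p) ℚ.+ e) ≡ e
    lem = solve-∀ ℚ-ring
    lem₂ : ∀ p e → ℚ.- (p ℚ.- 0ℚ) ℚ.+ (p ℚ.+ e) ≡ e
    lem₂ = solve-∀ ℚ-ring

  unit-interval : ∀ {x} → 0ℝ ≤ x → x ≤ 1ℝ → ∃[ c ] (x ≈ c × (∀ n → 0ℚ ℚ.≤ seq c n) × (∀ n → seq c n ℚ.≤ 1ℚ))
  unit-interval {x} 0≤x x≤1 = record { seq = c ; cauchy = ≋-trans (≋-sym x≋c) x≋c } , mk≈ x≋c , (0≤clamp ∘ seq x) , (clamp≤1 ∘ seq x)
    where
    c : ℕ → ℚ
    c = clamp ∘ seq x
    x≋c : seq x ≋ c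
    x≋c = ≋-near (cauchy x) λ ε 0<ε → ev-map (λ n (lo , hi) → clamp-near (ℚP.<⇒≤ 0<ε) lo hi) (ev-∧ (almost 0≤x ε 0<ε) (almost x≤1 ε 0<ε))

open UnitInterval

module RealPower (q : ℝ) (0<q : 0ℝ < q) (q<1 : q < 1ℝ) where

  s : ℕ → ℚ
  s n = seq q n ℚ.- 1ℚ

  s≋s : s ≋ s
  s≋s = ≋-+ (cauchy q) (≋-const (ℚ.- 1ℚ))

  ratio : ∃[ d ] (0ℚ ℚ.< d × Ratio s d)
  ratio = let ε , 0<ε , p = 0<-elim 0<q
              δ , 0<δ , r = gap q<1
          in ½ ℚ.* ε , 0<½* 0<ε , ev-map (λ n (a , b) → subst (∣ s n ∣ ℚ.≤_) (eq ε)
               (abs≤ (≤-by _ (0≤+ (0≤+ (0≤+ (0≤-sub b) (0≤-sub b)) (0≤+ (ℚP.<⇒≤ 0<δ) (ℚP.<⇒≤ 0<δ))) (0≤-sub a)) (lem₁ (seq q n) ε δ))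
                     (≤-by _ (0≤-sub a) (lem₂ (seq q n) ε)))) (ev-∧ p r)
    where
    eq : ∀ ε → 1ℚ ℚ.- ε ≡ 1ℚ ℚ.- ½ ℚ.* ε ℚ.- ½ ℚ.* ε
    eq ε = trans (cong (λ e → 1ℚ ℚ.- e) (sym (half+half ε))) (lem (½ ℚ.* ε))
      where
      lem : ∀ h → 1ℚ ℚ.- (h ℚ.+ h) ≡ 1ℚ ℚ.- h ℚ.- h
      lem = solve-∀ ℚ-ring
    lem₁ : ∀ q ε δ → (q ℚ.- 1ℚ) ℚ.+ (((1ℚ ℚ.- (q ℚ.+ δ)) ℚ.+ (1ℚ ℚ.- (q ℚ.+ δ))) ℚ.+ (δ ℚ.+ δ) ℚ.+ (q ℚ.- ε)) ≡ 1ℚ ℚ.- ε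
    lem₁ = solve-∀ ℚ-ring
    lem₂ : ∀ q ε → ℚ.- (q ℚ.- 1ℚ) ℚ.+ (q ℚ.- ε) ≡ 1ℚ ℚ.- ε
    lem₂ = solve-∀ ℚ-ring

  -- Newton's binomial series qˣ = Σₖ x(x - 1)⋯(x - k + 1)/k! · (q - 1)ᵏ, which
  -- converges because ∣ q - 1 ∣ < 1. By q^-homo, q^1 and q^x≤1 it is a homomorphism
  -- from (ℝ, +) to (ℝ, *) with value q at 1 that is bounded above on [0,1]; these
  -- properties single out the exponential with base q.
  infix 9 q^_
  q^_ : ℝ → ℝ
  seq    (q^ x) = λ n → binomialSum n (seq x n) (seq q n ℚ.- 1ℚ)
  cauchy (q^ x) = let d , 0<d , r = ratio in series-≋ 0<d r r (cauchy x) s≋s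

  q^-cong : ∀ {x y} → x ≈ y → q^ x ≈ q^ y
  q^-cong x≈y = let d , 0<d , r = ratio in mk≈ (series-≋ 0<d r r (seq-≋ x≈y) s≋s)

  q^-homo : ∀ x y → q^ x * q^ y ≈ q^ (x + y)
  q^-homo x y = let d , 0<d , r = ratio in mk≈ (series-homo 0<d r (cauchy x) (cauchy y) s≋s)

  eventually-≡ : ∀ {x y} → Eventually (λ n → seq x n ≡ seq y n) → x ≈ y
  eventually-≡ {x} {y} ev = mk≈ (≋-near (cauchy x) λ ε 0<ε → ev-map (λ n eq →
    subst (λ z → ∣ z ∣ ℚ.≤ ε) (sym (trans (cong (ℚ._- seq y n) eq) (ℚP.+-inverseʳ (seq y n)))) (ℚP.<⇒≤ 0<ε)) ev)

  zero* : ∀ {t} u → t ≡ 0ℚ → t ℚ.* u ≡ 0ℚ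
  zero* u refl = ℚP.*-zeroˡ u

  q^0 : q^ 0ℝ ≈ 1ℝ
  q^0 = eventually-≡ (1 , λ { (suc n) _ → sum n (s (suc n)) })
    where
    term : ∀ s k → binomialTerm 0ℚ s (suc k) ≡ 0ℚ
    term s zero    = lem (inv (ι 1)) s
      where
      lem : ∀ i s → 1ℚ ℚ.* ((0ℚ ℚ.- 0ℚ) ℚ.* i ℚ.* s) ≡ 0ℚ
      lem = solve-∀ ℚ-ring
    term s (suc k) = zero* ((0ℚ ℚ.- ι (suc k)) ℚ.* inv (ι (suc (suc k))) ℚ.* s) (term s k)
    sum : ∀ n s → Σℚ (suc n) (binomialTerm 0ℚ s) ≡ 1ℚ
    sum zero    s = refl
    sum (suc n) s = trans (cong₂ ℚ._+_ (sum n s) (term s n)) refl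

  q^1 : q^ 1ℝ ≈ q
  q^1 = eventually-≡ (2 , λ { (suc (suc n)) _ → trans (sum n (s (suc (suc n)))) (lem (seq q (suc (suc n)))) ; (suc zero) (s≤s ()) })
    where
    lem : ∀ q → 1ℚ ℚ.+ (q ℚ.- 1ℚ) ≡ q
    lem = solve-∀ ℚ-ring
    term : ∀ s k → binomialTerm 1ℚ s (suc (suc k)) ≡ 0ℚ
    term s zero    = lem′ (binomialTerm 1ℚ s 1) (inv (ι 2)) s
      where
      lem′ : ∀ t i s → t ℚ.* ((1ℚ ℚ.- 1ℚ) ℚ.* i ℚ.* s) ≡ 0ℚ
      lem′ = solve-∀ ℚ-ring
    term s (suc k) = zero* ((1ℚ ℚ.- ι (suc (suc k))) ℚ.* inv (ι (suc (suc (suc k)))) ℚ.* s) (term s k)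
    sum : ∀ n s → Σℚ (suc (suc n)) (binomialTerm 1ℚ s) ≡ 1ℚ ℚ.+ s
    sum zero    s = lem′ s
      where
      lem′ : ∀ s → 0ℚ ℚ.+ 1ℚ ℚ.+ 1ℚ ℚ.* ((1ℚ ℚ.- 0ℚ) ℚ.* 1ℚ ℚ.* s) ≡ 1ℚ ℚ.+ s
      lem′ = solve-∀ ℚ-ring
    sum (suc n) s = trans (cong₂ ℚ._+_ (sum n s) (term s n)) (ℚP.+-identityʳ _)

  q^-fromℕ : ∀ n → q^ (fromℕ n) ≈ q ^ n
  q^-fromℕ zero    = q^0
  q^-fromℕ (suc n) = R.trans (q^-cong (pointwise {fromℕ (suc n)} {1ℝ + fromℕ n} λ _ → refl)) (R.trans (R.sym (q^-homo 1ℝ (fromℕ n))) (R.*-cong q^1 (q^-fromℕ n)))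

  s-neg : ∃[ δ ] (0ℚ ℚ.< δ × Eventually (λ n → δ ℚ.≤ ℚ.- s n))
  s-neg = let δ , 0<δ , ev = gap q<1 in δ , 0<δ , ev-map (λ n p → ≤-by _ (0≤-sub p) (lem (seq q n) δ)) ev
    where
    lem : ∀ q δ → δ ℚ.+ (1ℚ ℚ.- (q ℚ.+ δ)) ≡ ℚ.- (q ℚ.- 1ℚ)
    lem = solve-∀ ℚ-ring

  1-q^>0 : ∀ n → 0ℝ < 1ℝ - q ^ (suc n)
  1-q^>0 n = let δ , 0<δ , sn = s-neg
                 ε , 0<ε , p = 0<-elim 0<q
    in 0<-intro δ 0<δ (ev-map (λ k (δ≤ , ε≤q) →
         let 0≤q = ℚP.≤-trans (ℚP.<⇒≤ 0<ε) ε≤q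
             q≤1 = ≤-by _ (ℚP.≤-trans (ℚP.<⇒≤ 0<δ) δ≤) (lem₁ (seq q k))
             1-x≥0 = 0≤-sub (proj₂ (bnd k 0≤q q≤1 n))
         in ≤-by _ (0≤+ (0≤-sub δ≤) (0≤* 0≤q 1-x≥0)) (lem₂ (seq q k) (seq (q ^ n) k) δ)) (ev-∧ sn p))
    where
    lem₁ : ∀ q → q ℚ.+ ℚ.- (q ℚ.- 1ℚ) ≡ 1ℚ
    lem₁ = solve-∀ ℚ-ring
    lem₂ : ∀ q x δ → δ ℚ.+ ((ℚ.- (q ℚ.- 1ℚ) ℚ.- δ) ℚ.+ q ℚ.* (1ℚ ℚ.- x)) ≡ 1ℚ ℚ.- q ℚ.* x
    lem₂ = solve-∀ ℚ-ring
    bnd : ∀ k → 0ℚ ℚ.≤ seq q k → seq q k ℚ.≤ 1ℚ → ∀ n → 0ℚ ℚ.≤ seq (q ^ n) k × seq (q ^ n) k ℚ.≤ 1ℚ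
    bnd k 0≤q q≤1 zero    = 0≤1 , ℚP.≤-refl
    bnd k 0≤q q≤1 (suc n) = let l , u = bnd k 0≤q q≤1 n in 0≤* 0≤q l , *-mono l 0≤1 q≤1 u

  bernoulli : ∀ {c s} → 0ℚ ℚ.≤ c → c ℚ.≤ 1ℚ → 0ℚ ℚ.≤ ℚ.- s → ∀ n → Σℚ (suc (suc n)) (binomialTerm c s) ℚ.≤ 1ℚ ℚ.+ c ℚ.* s
  bernoulli {c} {s} 0≤c c≤1 0≤-s zero    = ℚP.≤-reflexive (lem c s)
    where
    lem : ∀ c s → 0ℚ ℚ.+ 1ℚ ℚ.+ 1ℚ ℚ.* ((c ℚ.- 0ℚ) ℚ.* 1ℚ ℚ.* s) ≡ 1ℚ ℚ.+ c ℚ.* s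
    lem = solve-∀ ℚ-ring
  bernoulli {c} {s} 0≤c c≤1 0≤-s (suc n) = ℚP.≤-trans
    (≤-by (ℚ.- t (suc (suc n))) (nonpos (suc n)) (lem (Σℚ (suc (suc n)) t) (t (suc (suc n)))))
    (bernoulli 0≤c c≤1 0≤-s n)
    where
    t = binomialTerm c s
    lem : ∀ a b → a ℚ.+ b ℚ.+ ℚ.- b ≡ a
    lem = solve-∀ ℚ-ring
    nonpos : ∀ k → 0ℚ ℚ.≤ ℚ.- t (suc k)
    nonpos zero    = subst (0ℚ ℚ.≤_) (lem′ c s) (0≤* 0≤c 0≤-s)
      where
      lem′ : ∀ c s → c ℚ.* ℚ.- s ≡ ℚ.- (1ℚ ℚ.* ((c ℚ.- 0ℚ) ℚ.* 1ℚ ℚ.* s))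
      lem′ = solve-∀ ℚ-ring
    nonpos (suc k) = subst (0ℚ ℚ.≤_) (lem′ (t (suc k)) (ι (suc k)) c (inv (ι (suc (suc k)))) s)
      (0≤* (nonpos k) (0≤* (0≤* (0≤-sub (ℚP.≤-trans c≤1 (1≤ι k))) (ℚP.<⇒≤ (inv-pos (0<ι (suc k))))) 0≤-s))
      where
      lem′ : ∀ t k c i s → ℚ.- t ℚ.* ((k ℚ.- c) ℚ.* i ℚ.* ℚ.- s) ≡ ℚ.- (t ℚ.* ((c ℚ.- k) ℚ.* i ℚ.* s))
      lem′ = solve-∀ ℚ-ring

  q^x+q^[1-x]<2 : ∀ {x} → 0ℝ ≤ x → x ≤ 1ℝ → 0ℝ < (1ℝ - q^ x) + (1ℝ - q^ (1ℝ - x))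
  q^x+q^[1-x]<2 {x} 0≤x x≤1 =
    let c , x≈c , 0≤c , c≤1 = unit-interval 0≤x x≤1
        δ , 0<δ , N , sn = s-neg
    in 0<-resp-≈ (R.sym (R.+-cong (R.+-congˡ (R.-‿cong (q^-cong x≈c))) (R.+-congˡ (R.-‿cong (q^-cong (R.+-congˡ (R.-‿cong x≈c)))))))
        (0<-intro {(1ℝ - q^ c) + (1ℝ - q^ (1ℝ - c))} δ 0<δ (2 ℕ.+ N , λ where
          (suc (suc n)) (s≤s (s≤s N≤n)) →
             let k = suc (suc n)
                 δ≤ = sn k (ℕP.≤-trans N≤n (ℕP.≤-trans (ℕP.n≤1+n n) (ℕP.n≤1+n (suc n))))
                 0≤-s = ℚP.≤-trans (ℚP.<⇒≤ 0<δ) δ≤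
                 b₁ = bernoulli (0≤c k) (c≤1 k) 0≤-s n
                 b₂ = bernoulli {1ℚ ℚ.- seq c k} (0≤-sub (c≤1 k)) (≤-by (seq c k) (0≤c k) (lem₁ (seq c k))) 0≤-s n
             in ≤-by _ (0≤+ (0≤+ (0≤-sub δ≤) (0≤-sub b₁)) (0≤-sub b₂))
                  (lem₂ δ (s k) (seq c k) (seq (q^ c) k) (seq (q^ (1ℝ - c)) k))))
    where
    lem₁ : ∀ c → 1ℚ ℚ.- c ℚ.+ c ≡ 1ℚ
    lem₁ = solve-∀ ℚ-ring
    lem₂ : ∀ δ s c u v → δ ℚ.+ ((ℚ.- s ℚ.- δ) ℚ.+ ((1ℚ ℚ.+ c ℚ.* s) ℚ.- u) ℚ.+ ((1ℚ ℚ.+ (1ℚ ℚ.- c) ℚ.* s) ℚ.- v)) ≡ (1ℚ ℚ.- u) ℚ.+ (1ℚ ℚ.- v)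
    lem₂ = solve-∀ ℚ-ring

  q^x≤1 : ∀ {x} → 0ℝ ≤ x → x ≤ 1ℝ → q^ x ≤ 1ℝ
  q^x≤1 {x} 0≤x x≤1 =
    let c , x≈c , 0≤c , c≤1 = unit-interval 0≤x x≤1
        δ , 0<δ , M , sn = s-neg
    in mk≤ λ ε 0<ε → let N , near = close (seq-≋ (q^-cong x≈c)) ε 0<ε in
         2 ℕ.+ (M ℕ.+ N) , λ where
           (suc (suc n)) (s≤s (s≤s M+N≤n)) →
             let k = suc (suc n)
                 n≤k = ℕP.≤-trans (ℕP.n≤1+n n) (ℕP.n≤1+n (suc n))
                 N≤k = ℕP.≤-trans (ℕP.m+n≤o⇒n≤o M M+N≤n) n≤k
                 0≤-s = ℚP.≤-trans (ℚP.<⇒≤ 0<δ) (sn k (ℕP.≤-trans (ℕP.m+n≤o⇒m≤o M M+N≤n) n≤k))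
                 b = bernoulli (0≤c k) (c≤1 k) 0≤-s n
                 d = ℚP.≤-trans (p≤∣p∣ (seq (q^ x) k ℚ.- seq (q^ c) k)) (near k k N≤k N≤k)
             in ≤-by _ (0≤+ (0≤+ (0≤-sub d) (0≤-sub b)) (0≤* (0≤c k) 0≤-s))
                  (lem (seq (q^ x) k) (seq (q^ c) k) ε (seq c k) (s k))
    where
    lem : ∀ u v e c s → u ℚ.+ ((e ℚ.- (u ℚ.- v)) ℚ.+ ((1ℚ ℚ.+ c ℚ.* s) ℚ.- v) ℚ.+ c ℚ.* ℚ.- s) ≡ 1ℚ ℚ.+ e
    lem = solve-∀ ℚ-ring

sumℝ : ℕ → (ℕ → ℝ) → ℝ
sumℝ zero    f = 0ℝ
sumℝ (suc n) f = sumℝ n f + f n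

Σ-range : ℕ → ℕ → (ℕ → ℝ) → ℝ
Σ-range a b f = sumℝ (suc b ∸ a) (λ i → f (a ℕ.+ i))

infix 5 Σ-range
syntax Σ-range a b (λ k → e) = Σ[ k ∈ a ⋯ b ] e

binomials#0 : ∀ {n m l} → l ℕ.≤ n → l ℕ.≤ m → fromℕ (n C l) * fromℕ (m C l) # 0ℝ
binomials#0 l≤n l≤m = >0⇒#0 (0<-* (fromℕ-0< (C-pos l≤n)) (fromℕ-0< (C-pos l≤m)))

module q-Calculus (q : ℝ) (0<q : 0ℝ < q) (q<1 : q < 1ℝ) where
  open RealPower q 0<q q<1 public

  1-q>0 : 0ℝ < 1ℝ - q
  1-q>0 = <⇒0<- q<1

  [_]q : ℝ → ℝ
  [ x ]q = (1ℝ - q^ x) ÷ (1ℝ - q) [ >0⇒#0 1-q>0 ]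

  [_]q! : ℕ → ℝ
  [ zero  ]q! = 1ℝ
  [ suc k ]q! = [ k ]q! * [ fromℕ (suc k) ]q

  [suc]q>0 : ∀ k → 0ℝ < [ fromℕ (suc k) ]q
  [suc]q>0 k = 0<-* (0<-resp-≈ (R.+-congˡ (R.-‿cong (R.sym (q^-fromℕ (suc k))))) (1-q^>0 k))
                    (0<-recip (>0⇒#0 1-q>0) 1-q>0)

  q!>0 : ∀ k → 0ℝ < [ k ]q!
  q!>0 zero    = 0<1ℝ
  q!>0 (suc k) = 0<-* (q!>0 k) ([suc]q>0 k)

  -- [x]_q [x - 1]_q ⋯ [x - k + 1]_q
  qFalling : ℝ → ℕ → ℝ
  qFalling x zero    = 1ℝ
  qFalling x (suc k) = qFalling x k * [ x - fromℕ k ]q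

  qBinomial : ℝ → ℕ → ℝ
  qBinomial x k = qFalling x k ÷ [ k ]q! [ >0⇒#0 (q!>0 k) ]

  -- only meaningful for i ≤ k, because of the truncated subtraction
  qBinomialℕ : ℕ → ℕ → ℝ
  qBinomialℕ k i = [ k ]q! ÷ ([ i ]q! * [ k ∸ i ]q!) [ >0⇒#0 (0<-* (q!>0 i) (q!>0 (k ∸ i))) ]

  -- x ^ 0 is 1ℝ for every x, including x = 0ℝ
  qStirling : ℕ → ℕ → ℝ
  qStirling n k =
    q^ (- fromℕ (k C 2)) ÷ [ k ]q! [ >0⇒#0 (q!>0 k) ] *
    (Σ[ i ∈ 0 ⋯ k ] (- 1ℝ) ^ i * q^ (fromℕ (i C 2)) * qBinomialℕ k i * [ fromℕ (k ∸ i) ]q ^ n)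

  qBernstein : ℤ → ℤ → ℤ → ℤ → ℝ → ℝ → ℝ
  qBernstein (ℤ.+ k) (ℤ.+ j) (ℤ.+ n) (ℤ.+ m) x y with (k ℕP.≤? n) ×-dec (j ℕP.≤? m)
  ... | yes _ = fromℕ (n C k) * fromℕ (m C j) * [ x ]q ^ k * [ y ]q ^ j *
                [ 1ℝ - x ]q ^ (n ∸ k) * [ 1ℝ - y ]q ^ (m ∸ j)
  ... | no  _ = 0ℝ
  qBernstein _ _ _ _ x y = 0ℝ

  [x]+[1-x]>0 : ∀ {x} → 0ℝ ≤ x → x ≤ 1ℝ → 0ℝ < [ x ]q + [ 1ℝ - x ]q
  [x]+[1-x]>0 {x} 0≤x x≤1 = 0<-resp-≈ (R.distribʳ _ _ _)
    (0<-* (q^x+q^[1-x]<2 0≤x x≤1) (0<-recip (>0⇒#0 1-q>0) 1-q>0))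

  denominator#0 : ∀ {x y} → 0ℝ ≤ x → x ≤ 1ℝ → 0ℝ ≤ y → y ≤ 1ℝ → ∀ a b →
                  ([ x ]q + [ 1ℝ - x ]q) ^ a * ([ y ]q + [ 1ℝ - y ]q) ^ b # 0ℝ
  denominator#0 0≤x x≤1 0≤y y≤1 a b =
    >0⇒#0 (0<-* (0<-^ a ([x]+[1-x]>0 0≤x x≤1)) (0<-^ b ([x]+[1-x]>0 0≤y y≤1)))

{-# OPTIONS --safe #-}
module Submission where

-- Both sides equal [x]_q^l [y]_q^l. On the left, the weights are absorbed by
-- C(k,l) C(n,k) = C(n,l) C(n-l,k-l), and the binomial theorem then produces the
-- normalising power. On the right, put S'(l,k) = q^C(k,2) S(l,k); the explicit
-- formula and the addition rule [a+b]_q = [a]_q + q^a [b]_q give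
-- S'(l+1,k+1) = [k+1]_q S'(l,k+1) + q^k S'(l,k), and the rule
-- [x]_q F_k = [k]_q F_k + q^k F_(k+1) for the falling products
-- F_k = [x]_q ⋯ [x-k+1]_q then yields Σ_k F_k S'(l,k) = [x]_q^l by induction on l.

open import Defs
open import Algebra.Bundles using (CommutativeRing)
import Algebra.Properties.CommutativeSemiring.Binomial as Binomial
import Algebra.Properties.Semiring.Exp as Exp
import Algebra.Properties.Semiring.Mult as Mult
import Algebra.Properties.Semiring.Sum as Sum
open import Data.Empty using (⊥-elim)
open import Data.Fin.Base using (toℕ)
open import Data.Nat.Base as ℕ using (ℕ; zero; suc; _∸_; _!; s≤s)
open import Data.Nat.Combinatorics using (_C_; nCk≡n!/k![n-k]!; k![n∸k]!∣n!; nCk+nC[k+1]≡[n+1]C[k+1]; nC1≡n)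
open import Data.Nat.DivMod using (m/n*n≡m)
import Data.Nat.Properties as ℕP
open import Data.Nat.Tactic.RingSolver using () renaming (solve-∀ to solveℕ-∀)
open import Data.Integer.Base using (+_)
open import Data.Product.Base using (_,_)
import Data.Rational.Base as ℚ
import Data.Rational.Properties as ℚP
open import Function.Base using (_∘_)
open import Relation.Binary.PropositionalEquality as ≡ using (_≡_; cong; cong₂; subst)
open import Relation.Nullary using (yes; no)
open import Relation.Nullary.Decidable using (_×-dec_)
open import Tactic.RingSolver using (solve-∀)

open RationalFacts using (ℚ-ring; ι-+)

private module R = CommutativeRing ℝ-commutativeRing

open import Relation.Binary.Reasoning.Setoid R.setoid

open import Algebra.Solver.Ring.NaturalCoefficients.Default R.commutativeSemiring using (solve; _:+_; _:*_; _:=_)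

-- Finite sums of reals and the embedding of the naturals.

sum-cong : ∀ n {f g : ℕ → ℝ} → (∀ i → i ℕ.< n → f i ≈ g i) → sumℝ n f ≈ sumℝ n g
sum-cong zero    f≈g = R.refl
sum-cong (suc n) f≈g = R.+-cong (sum-cong n λ i i<n → f≈g i (ℕP.m<n⇒m<1+n i<n)) (f≈g n ℕP.≤-refl)

sum-zero : ∀ n {f : ℕ → ℝ} → (∀ i → i ℕ.< n → f i ≈ 0ℝ) → sumℝ n f ≈ 0ℝ
sum-zero zero    f≈0 = R.refl
sum-zero (suc n) f≈0 = R.trans (R.+-cong (sum-zero n λ i i<n → f≈0 i (ℕP.m<n⇒m<1+n i<n)) (f≈0 n ℕP.≤-refl)) (R.+-identityˡ 0ℝ)

sum-+ : ∀ n (f g : ℕ → ℝ) → sumℝ n (λ i → f i + g i) ≈ sumℝ n f + sumℝ n g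
sum-+ zero    f g = R.sym (R.+-identityˡ 0ℝ)
sum-+ (suc n) f g = R.trans (R.+-congʳ (sum-+ n f g)) 
  (solve 4 (λ a b c d → (a :+ b) :+ (c :+ d) := (a :+ c) :+ (b :+ d)) R.refl (sumℝ n f) (sumℝ n g) (f n) (g n))

*-sum : ∀ c n (f : ℕ → ℝ) → c * sumℝ n f ≈ sumℝ n (λ i → c * f i)
*-sum c zero    f = R.zeroʳ c
*-sum c (suc n) f = R.trans (R.distribˡ c (sumℝ n f) (f n)) (R.+-congʳ (*-sum c n f))

sum-* : ∀ n (f : ℕ → ℝ) c → sumℝ n f * c ≈ sumℝ n (λ i → f i * c)
sum-* zero    f c = R.zeroˡ c
sum-* (suc n) f c = R.trans (R.distribʳ c (sumℝ n f) (f n)) (R.+-congʳ (sum-* n f c))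

sum-front : ∀ n (f : ℕ → ℝ) → sumℝ (suc n) f ≈ f 0 + sumℝ n (f ∘ suc)
sum-front zero    f = R.+-comm 0ℝ (f 0)
sum-front (suc n) f = R.trans (R.+-congʳ (sum-front n f)) (R.+-assoc (f 0) (sumℝ n (f ∘ suc)) (f (suc n)))

sum-product : ∀ m n (f g : ℕ → ℝ) → sumℝ m (λ i → sumℝ n (λ j → f i * g j)) ≈ sumℝ m f * sumℝ n g
sum-product m n f g = R.trans (sum-cong m λ i _ → R.sym (*-sum (f i) n g)) (R.sym (sum-* m f (sumℝ n g)))

fromℕ-+ : ∀ m n → fromℕ (m ℕ.+ n) ≈ fromℕ m + fromℕ n
fromℕ-+ m n = pointwise λ _ → ι-+ m n

fromℕ-* : ∀ m n → fromℕ (m ℕ.* n) ≈ fromℕ m * fromℕ n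
fromℕ-* m n = pointwise λ _ → ι-* m n
  where
  lem : ∀ m n → n ℚ.+ m ℚ.* n ≡ (ℚ.1ℚ ℚ.+ m) ℚ.* n
  lem = solve-∀ ℚ-ring
  ι-* : ∀ m n → ι (m ℕ.* n) ≡ ι m ℚ.* ι n
  ι-* zero    n = ≡.sym (ℚP.*-zeroˡ (ι n))
  ι-* (suc m) n = ≡.trans (ι-+ n (m ℕ.* n)) (≡.trans (cong (ι n ℚ.+_) (ι-* m n)) (lem (ι m) (ι n)))

-- The binomial theorem over the reals.

module BinomialTheorem (a b : ℝ) where
  open Sum R.semiring using (sum; sum-cong-≋)
  open Mult R.semiring using (_×_)

  -- The sum over `Fin n` peels off its first term and `sumℝ` its last, so `sum-front` reconciles
  -- the two recursions.
  sum≈sumℝ : ∀ n (f : ℕ → ℝ) → sum {n} (f ∘ toℕ) ≈ sumℝ n f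
  sum≈sumℝ zero    f = R.refl
  sum≈sumℝ (suc n) f = R.trans (R.+-congˡ (sum≈sumℝ n (f ∘ suc))) (R.sym (sum-front n f))

  ×≈fromℕ* : ∀ n x → n × x ≈ fromℕ n * x
  ×≈fromℕ* zero    x = R.sym (R.zeroˡ x)
  ×≈fromℕ* (suc n) x = begin
    x + n × x               ≈⟨ R.+-cong (R.sym (R.*-identityˡ x)) (×≈fromℕ* n x) ⟩
    1ℝ * x + fromℕ n * x    ≈⟨ R.distribʳ x 1ℝ (fromℕ n) ⟨
    (1ℝ + fromℕ n) * x      ≈⟨ R.*-congʳ (fromℕ-+ 1 n) ⟨
    fromℕ (suc n) * x       ∎

  binomial-theorem : ∀ n → (a + b) ^ n ≈ sumℝ (suc n) (λ i → fromℕ (n C i) * (a ^ i * b ^ (n ∸ i)))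
  binomial-theorem n = begin
    (a + b) ^ n                                              ≈⟨ Binomial.theorem R.commutativeSemiring n a b ⟩
    sum {suc n} (λ k → (n C toℕ k) × (a ^ toℕ k * b ^ (n ∸ toℕ k)))   ≈⟨ sum-cong-≋ {suc n} (λ k → ×≈fromℕ* (n C toℕ k) (a ^ toℕ k * b ^ (n ∸ toℕ k))) ⟩
    sum {suc n} ((λ i → fromℕ (n C i) * (a ^ i * b ^ (n ∸ i))) ∘ toℕ)  ≈⟨ sum≈sumℝ (suc n) (λ i → fromℕ (n C i) * (a ^ i * b ^ (n ∸ i))) ⟩
    sumℝ (suc n) (λ i → fromℕ (n C i) * (a ^ i * b ^ (n ∸ i)))  ∎

open BinomialTheorem using (binomial-theorem)

-- Products of binomial coefficients.

-- The factorial formula is a quotient of naturals; the division is exact because the denominator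
-- divides `(a + b) !`. Writing the upper index as a sum avoids truncated subtraction.
C-! : ∀ a b → ((a ℕ.+ b) C a) ℕ.* (a ! ℕ.* b !) ≡ (a ℕ.+ b) !
C-! a b = subst (λ c → ((a ℕ.+ b) C a) ℕ.* (a ! ℕ.* c !) ≡ (a ℕ.+ b) !) (ℕP.m+n∸m≡n a b)
  (≡.trans (cong (ℕ._* (a ! ℕ.* (a ℕ.+ b ∸ a) !)) (nCk≡n!/k![n-k]! (ℕP.m≤m+n a b)))
    (m/n*n≡m {{a ℕP.!* (a ℕ.+ b ∸ a) !≢0}} (k![n∸k]!∣n! (ℕP.m≤m+n a b))))

-- Multiplied by l! i! p!, either side collapses to (l + i + p)! by two uses of `C-!`; the nonzero
-- factor is then cancelled.
C-trinomial : ∀ l i p → ((l ℕ.+ i) C l) ℕ.* ((l ℕ.+ (i ℕ.+ p)) C (l ℕ.+ i)) ≡ ((l ℕ.+ (i ℕ.+ p)) C l) ℕ.* ((i ℕ.+ p) C i)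
C-trinomial l i p = ℕP.*-cancelʳ-≡ _ _ (l ! ℕ.* (i ! ℕ.* p !)) {{l!i!p!≢0}} (≡.trans left (≡.sym right))
  where
  l!i!p!≢0 : ℕ.NonZero (l ! ℕ.* (i ! ℕ.* p !))
  l!i!p!≢0 = ℕP.m*n≢0 (l !) (i ! ℕ.* p !) {{l ℕP.!≢0}} {{i ℕP.!* p !≢0}}
  lem₁ : ∀ A B l i p → A ℕ.* B ℕ.* (l ℕ.* (i ℕ.* p)) ≡ B ℕ.* ((A ℕ.* (l ℕ.* i)) ℕ.* p)
  lem₁ = solveℕ-∀
  lem₂ : ∀ D E l i p → D ℕ.* E ℕ.* (l ℕ.* (i ℕ.* p)) ≡ D ℕ.* (l ℕ.* (E ℕ.* (i ℕ.* p)))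
  lem₂ = solveℕ-∀
  left : ((l ℕ.+ i) C l) ℕ.* ((l ℕ.+ (i ℕ.+ p)) C (l ℕ.+ i)) ℕ.* (l ! ℕ.* (i ! ℕ.* p !)) ≡ (l ℕ.+ (i ℕ.+ p)) !
  left = ≡.trans (lem₁ ((l ℕ.+ i) C l) ((l ℕ.+ (i ℕ.+ p)) C (l ℕ.+ i)) (l !) (i !) (p !))
    (≡.trans (cong (λ z → ((l ℕ.+ (i ℕ.+ p)) C (l ℕ.+ i)) ℕ.* (z ℕ.* p !)) (C-! l i))
      (subst (λ n → (n C (l ℕ.+ i)) ℕ.* ((l ℕ.+ i) ! ℕ.* p !) ≡ n !) (ℕP.+-assoc l i p) (C-! (l ℕ.+ i) p)))
  right : ((l ℕ.+ (i ℕ.+ p)) C l) ℕ.* ((i ℕ.+ p) C i) ℕ.* (l ! ℕ.* (i ! ℕ.* p !)) ≡ (l ℕ.+ (i ℕ.+ p)) !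
  right = ≡.trans (lem₂ ((l ℕ.+ (i ℕ.+ p)) C l) ((i ℕ.+ p) C i) (l !) (i !) (p !))
    (≡.trans (cong (λ z → ((l ℕ.+ (i ℕ.+ p)) C l) ℕ.* (l ! ℕ.* z)) (C-! i p)) (C-! l (i ℕ.+ p)))

C-subset-of-subset : ∀ {n l i} → l ℕ.≤ n → i ℕ.≤ n ∸ l →
  ((l ℕ.+ i) C l) ℕ.* (n C (l ℕ.+ i)) ≡ (n C l) ℕ.* ((n ∸ l) C i)
C-subset-of-subset {n} {l} {i} l≤n i≤n∸l =
  subst (λ N → ((l ℕ.+ i) C l) ℕ.* (n C (l ℕ.+ i)) ≡ (n C l) ℕ.* (N C i)) (ℕP.m+[n∸m]≡n i≤n∸l)
    (subst (λ n → ((l ℕ.+ i) C l) ℕ.* (n C (l ℕ.+ i)) ≡ (n C l) ℕ.* ((i ℕ.+ p) C i))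
      (≡.trans (cong (l ℕ.+_) (ℕP.m+[n∸m]≡n i≤n∸l)) (ℕP.m+[n∸m]≡n l≤n)) (C-trinomial l i p))
  where p = n ∸ l ∸ i

-- The one-variable Bernstein sum.

i<1+n∸l⇒l+i≤n : ∀ {n l i} → l ℕ.≤ n → i ℕ.< suc n ∸ l → l ℕ.+ i ℕ.≤ n
i<1+n∸l⇒l+i≤n {n} {l} {i} l≤n i<1+n∸l = ℕP.≤-pred (subst (ℕ._≤ suc n) (ℕP.+-suc l i)
  (subst (l ℕ.+ suc i ℕ.≤_) (ℕP.m+[n∸m]≡n (ℕP.m≤n⇒m≤1+n l≤n)) (ℕP.+-monoʳ-≤ l i<1+n∸l)))

-- Used with `a` = [x]_q and `b` = [1-x]_q. Their sum is in general not 1, so a power of `a + b`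
-- survives; it is what the denominator of the theorem removes.
bernstein-sum : ∀ {n l} → l ℕ.≤ n → ∀ a b →
  (Σ[ k ∈ l ⋯ n ] fromℕ (k C l) * (fromℕ (n C k) * (a ^ k * b ^ (n ∸ k)))) ≈
  fromℕ (n C l) * (a ^ l * (a + b) ^ (n ∸ l))
bernstein-sum {n} {l} l≤n a b = begin
  -- The number of summands takes the form required by the binomial theorem with exponent `n ∸ l`
  -- only because `l ≤ n`.
  sumℝ (suc n ∸ l) t                                  ≡⟨ cong (λ N → sumℝ N t) (ℕP.+-∸-assoc 1 l≤n) ⟩
  sumℝ (suc (n ∸ l)) t                                ≈⟨ sum-cong (suc (n ∸ l)) term ⟩
  sumℝ (suc (n ∸ l)) (λ i → c * (a ^ l * u i))        ≈⟨ *-sum c (suc (n ∸ l)) (λ i → a ^ l * u i) ⟨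
  c * sumℝ (suc (n ∸ l)) (λ i → a ^ l * u i)          ≈⟨ R.*-congˡ (*-sum (a ^ l) (suc (n ∸ l)) u) ⟨
  c * (a ^ l * sumℝ (suc (n ∸ l)) u)                  ≈⟨ R.*-congˡ (R.*-congˡ (binomial-theorem a b (n ∸ l))) ⟨
  c * (a ^ l * (a + b) ^ (n ∸ l))                     ∎
  where
  open Exp R.semiring using (^-homo-*)
  c = fromℕ (n C l)
  t u : ℕ → ℝ
  t i = fromℕ ((l ℕ.+ i) C l) * (fromℕ (n C (l ℕ.+ i)) * (a ^ (l ℕ.+ i) * b ^ (n ∸ (l ℕ.+ i))))
  u i = fromℕ ((n ∸ l) C i) * (a ^ i * b ^ (n ∸ l ∸ i))
  lem : ∀ c d x y z → c * d * ((x * y) * z) ≈ c * (x * (d * (y * z)))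
  lem = solve 5 (λ c d x y z → c :* d :* ((x :* y) :* z) := c :* (x :* (d :* (y :* z)))) R.refl
  term : ∀ i → i ℕ.< suc (n ∸ l) → t i ≈ c * (a ^ l * u i)
  term i (s≤s i≤n∸l) = begin
    t i
      ≈⟨ R.*-assoc (fromℕ ((l ℕ.+ i) C l)) (fromℕ (n C (l ℕ.+ i))) _ ⟨
    fromℕ ((l ℕ.+ i) C l) * fromℕ (n C (l ℕ.+ i)) * (a ^ (l ℕ.+ i) * b ^ (n ∸ (l ℕ.+ i)))
      ≈⟨ R.*-congʳ (fromℕ-* ((l ℕ.+ i) C l) (n C (l ℕ.+ i))) ⟨
    fromℕ (((l ℕ.+ i) C l) ℕ.* (n C (l ℕ.+ i))) * (a ^ (l ℕ.+ i) * b ^ (n ∸ (l ℕ.+ i)))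
      ≡⟨ cong₂ (λ z e → fromℕ z * (a ^ (l ℕ.+ i) * b ^ e)) (C-subset-of-subset l≤n i≤n∸l) (≡.sym (ℕP.∸-+-assoc n l i)) ⟩
    fromℕ ((n C l) ℕ.* ((n ∸ l) C i)) * (a ^ (l ℕ.+ i) * b ^ (n ∸ l ∸ i))
      ≈⟨ R.*-cong (fromℕ-* (n C l) ((n ∸ l) C i)) (R.*-congʳ (^-homo-* a l i)) ⟩
    c * fromℕ ((n ∸ l) C i) * ((a ^ l * a ^ i) * b ^ (n ∸ l ∸ i))
      ≈⟨ lem c (fromℕ ((n ∸ l) C i)) (a ^ l) (a ^ i) (b ^ (n ∸ l ∸ i)) ⟩
    c * (a ^ l * u i) ∎

-- Reciprocals.

inverse-unique : ∀ {x y z} → x * y ≈ 1ℝ → x * z ≈ 1ℝ → y ≈ z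
inverse-unique {x} {y} {z} xy≈1 xz≈1 = begin
  y            ≈⟨ R.*-identityʳ y ⟨
  y * 1ℝ       ≈⟨ R.*-congˡ xz≈1 ⟨
  y * (x * z)  ≈⟨ solve 3 (λ x y z → y :* (x :* z) := (x :* y) :* z) R.refl x y z ⟩
  (x * y) * z  ≈⟨ R.*-congʳ xy≈1 ⟩
  1ℝ * z       ≈⟨ R.*-identityˡ z ⟩
  z            ∎

-- The three apartness proofs are independent arguments, so the rule fits whatever proofs the
-- definitions happen to carry.
recip-* : ∀ {x y} x#0 y#0 xy#0 → recip (x * y) xy#0 ≈ recip x x#0 * recip y y#0
recip-* {x} {y} x#0 y#0 xy#0 = inverse-unique (recip-inverse (x * y) xy#0) (begin
  (x * y) * (recip x x#0 * recip y y#0)  ≈⟨ solve 4 (λ x y a b → (x :* y) :* (a :* b) := (x :* a) :* (y :* b)) R.refl x y (recip x x#0) (recip y y#0) ⟩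
  (x * recip x x#0) * (y * recip y y#0)  ≈⟨ R.*-cong (recip-inverse x x#0) (recip-inverse y y#0) ⟩
  1ℝ * 1ℝ                                ≈⟨ R.*-identityˡ 1ℝ ⟩
  1ℝ                                     ∎)

x*y≈0⇒y≈0 : ∀ {x y} → x # 0ℝ → x * y ≈ 0ℝ → y ≈ 0ℝ
x*y≈0⇒y≈0 {x} {y} x#0 xy≈0 = begin
  y                     ≈⟨ R.*-identityˡ y ⟨
  1ℝ * y                ≈⟨ R.*-congʳ (recip-inverse x x#0) ⟨
  x * recip x x#0 * y   ≈⟨ solve 3 (λ x y a → (x :* a) :* y := a :* (x :* y)) R.refl x y (recip x x#0) ⟩
  recip x x#0 * (x * y) ≈⟨ R.*-congˡ xy≈0 ⟩
  recip x x#0 * 0ℝ      ≈⟨ R.zeroʳ (recip x x#0) ⟩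
  0ℝ                    ∎

module _ (q : ℝ) (0<q : 0ℝ < q) (q<1 : q < 1ℝ) where
  open q-Calculus q 0<q q<1

  -- Arithmetic of q-numbers and q-factorials.

  []q-cong : ∀ {x y} → x ≈ y → [ x ]q ≈ [ y ]q
  []q-cong x≈y = R.*-congʳ (R.+-congˡ (R.-‿cong (q^-cong x≈y)))

  -- With a = q^x and b = q^y this is 1 - ab = (1 - a) + a(1 - b), divided by 1 - q.
  [x+y]q : ∀ x y → [ x + y ]q ≈ [ x ]q + q^ x * [ y ]q
  [x+y]q x y = begin
    (1ℝ - q^ (x + y)) * r                       ≈⟨ R.*-congʳ (R.+-congˡ (R.-‿cong (q^-homo x y))) ⟨
    -- The identity involves subtraction and is checked term by term on the rational sequences.
    (1ℝ - q^ x * q^ y) * r                      ≈⟨ pointwise (λ n → lem (seq (q^ x) n) (seq (q^ y) n) (seq r n)) ⟩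
    (1ℝ - q^ x) * r + q^ x * ((1ℝ - q^ y) * r)  ∎
    where
    r = recip (1ℝ - q) (>0⇒#0 1-q>0)
    lem : ∀ a b r → (ℚ.1ℚ ℚ.- a ℚ.* b) ℚ.* r ≡ (ℚ.1ℚ ℚ.- a) ℚ.* r ℚ.+ a ℚ.* ((ℚ.1ℚ ℚ.- b) ℚ.* r)
    lem = solve-∀ ℚ-ring

  [0]q : [ 0ℝ ]q ≈ 0ℝ
  [0]q = begin
    (1ℝ - q^ 0ℝ) * r  ≈⟨ R.*-congʳ (R.trans (R.+-congˡ (R.-‿cong q^0)) (R.-‿inverseʳ 1ℝ)) ⟩
    0ℝ * r            ≈⟨ R.zeroˡ r ⟩
    0ℝ                ∎
    where r = recip (1ℝ - q) (>0⇒#0 1-q>0)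

  recip-q! : ℕ → ℝ
  recip-q! k = recip [ k ]q! (>0⇒#0 (q!>0 k))

  q!-inverse : ∀ k → [ k ]q! * recip-q! k ≈ 1ℝ
  q!-inverse k = recip-inverse [ k ]q! (>0⇒#0 (q!>0 k))

  -- Both sides are inverse to `[ k ]q!`.
  recip-q!-suc : ∀ k → [ fromℕ (suc k) ]q * recip-q! (suc k) ≈ recip-q! k
  recip-q!-suc k = inverse-unique
    (R.trans (R.sym (R.*-assoc [ k ]q! [ fromℕ (suc k) ]q (recip-q! (suc k)))) (q!-inverse (suc k)))
    (q!-inverse k)

  -- The q-Stirling numbers as a convolution.

  -- Dividing the explicit formula by [k]_q! turns it into a convolution in k:
  -- stirlingConv l k is S'(l,k).
  coeff : ℕ → ℝ
  coeff i = (- 1ℝ) ^ i * q^ (fromℕ (i C 2)) * recip-q! i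

  moment : ℕ → ℕ → ℝ
  moment l j = [ fromℕ j ]q ^ l * recip-q! j

  stirlingConv : ℕ → ℕ → ℝ
  stirlingConv l k = sumℝ (suc k) (λ i → coeff i * moment l (k ∸ i))

  -- The prefactor 1/[k]_q! cancels the numerator of each q-binomial coefficient, and the remaining
  -- 1/([i]_q! [k-i]_q!) is shared between `coeff` and `moment`.
  qStirling≈ : ∀ l k → qStirling l k ≈ q^ (- fromℕ (k C 2)) * stirlingConv l k
  qStirling≈ l k = begin
    Q * e * sumℝ (suc k) t                   ≈⟨ R.*-assoc Q e (sumℝ (suc k) t) ⟩
    Q * (e * sumℝ (suc k) t)                 ≈⟨ R.*-congˡ (*-sum e (suc k) t) ⟩
    Q * sumℝ (suc k) (λ i → e * t i)         ≈⟨ R.*-congˡ (sum-cong (suc k) λ i _ → term i) ⟩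
    Q * stirlingConv l k                     ∎
    where
    Q = q^ (- fromℕ (k C 2))
    e = recip-q! k
    t : ℕ → ℝ
    t i = (- 1ℝ) ^ i * q^ (fromℕ (i C 2)) * qBinomialℕ k i * [ fromℕ (k ∸ i) ]q ^ l
    term : ∀ i → e * t i ≈ coeff i * moment l (k ∸ i)
    term i = begin
      e * (m * P * ([ k ]q! * r) * p)
        ≈⟨ R.*-congˡ (R.*-congʳ (R.*-congˡ (R.*-congˡ (recip-* (>0⇒#0 (q!>0 i)) (>0⇒#0 (q!>0 (k ∸ i))) i![k∸i]!#0)))) ⟩
      e * (m * P * ([ k ]q! * (recip-q! i * recip-q! (k ∸ i))) * p)
        ≈⟨ solve 7 (λ e m P K a b p → e :* (m :* P :* (K :* (a :* b)) :* p) := (K :* e) :* (m :* P :* a :* (p :* b))) R.refl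
             e m P [ k ]q! (recip-q! i) (recip-q! (k ∸ i)) p ⟩
      ([ k ]q! * e) * (coeff i * moment l (k ∸ i))
        ≈⟨ R.*-congʳ (q!-inverse k) ⟩
      1ℝ * (coeff i * moment l (k ∸ i))
        ≈⟨ R.*-identityˡ _ ⟩
      coeff i * moment l (k ∸ i) ∎
      where
      m = (- 1ℝ) ^ i
      P = q^ (fromℕ (i C 2))
      p = [ fromℕ (k ∸ i) ]q ^ l
      i![k∸i]!#0 = >0⇒#0 (0<-* (q!>0 i) (q!>0 (k ∸ i)))
      r = recip ([ i ]q! * [ k ∸ i ]q!) i![k∸i]!#0

  -- The recurrence for the convolution.

  -- Since C(i+1,2) = i + C(i,2) and [i+1]_q / [i+1]_q! = 1/[i]_q!, the two terms differ only in
  -- sign.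
  coeff-suc : ∀ i → [ fromℕ (suc i) ]q * coeff (suc i) + q^ (fromℕ i) * coeff i ≈ 0ℝ
  coeff-suc i = begin
    N * (- 1ℝ * m * q^ (fromℕ (suc i C 2)) * e′) + Q * (m * P * recip-q! i)
      ≈⟨ R.+-cong (R.*-congˡ (R.*-congʳ (R.*-congˡ split))) (R.*-congˡ (R.*-congˡ (R.sym (recip-q!-suc i)))) ⟩
    N * (- 1ℝ * m * (Q * P) * e′) + Q * (m * P * (N * e′))
      ≈⟨ pointwise (λ n → lem (seq N n) (seq m n) (seq Q n) (seq P n) (seq e′ n)) ⟩
    0ℝ ∎
    where
    N = [ fromℕ (suc i) ]q
    m = (- 1ℝ) ^ i
    e′ = recip-q! (suc i)
    Q = q^ (fromℕ i)
    P = q^ (fromℕ (i C 2))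
    split : q^ (fromℕ (suc i C 2)) ≈ Q * P
    split = begin
      q^ (fromℕ (suc i C 2))         ≡⟨ cong (λ c → q^ (fromℕ c)) (≡.sym (nCk+nC[k+1]≡[n+1]C[k+1] i 1)) ⟩
      q^ (fromℕ (i C 1 ℕ.+ i C 2))   ≡⟨ cong (λ c → q^ (fromℕ (c ℕ.+ i C 2))) (nC1≡n i) ⟩
      q^ (fromℕ (i ℕ.+ i C 2))       ≈⟨ q^-cong (fromℕ-+ i (i C 2)) ⟩
      q^ (fromℕ i + fromℕ (i C 2))   ≈⟨ q^-homo (fromℕ i) (fromℕ (i C 2)) ⟨
      Q * P                          ∎
    lem : ∀ N m Q P e → N ℚ.* (ℚ.- ℚ.1ℚ ℚ.* m ℚ.* (Q ℚ.* P) ℚ.* e) ℚ.+ Q ℚ.* (m ℚ.* P ℚ.* (N ℚ.* e)) ≡ ℚ.0ℚ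
    lem = solve-∀ ℚ-ring

  moment-suc : ∀ l j → moment (suc l) j ≈ [ fromℕ j ]q * moment l j
  moment-suc l j = R.*-assoc [ fromℕ j ]q ([ fromℕ j ]q ^ l) (recip-q! j)

  -- The positive exponent matters: `moment 0 0` is 1 by the convention 0^0 = 1.
  moment-suc-0 : ∀ l → moment (suc l) 0 ≈ 0ℝ
  moment-suc-0 l = R.trans (moment-suc l 0) (R.trans (R.*-congʳ [0]q) (R.zeroˡ (moment l 0)))

  fromℕ-∸ : ∀ {i k} → i ℕ.≤ k → fromℕ k ≈ fromℕ (k ∸ i) + fromℕ i
  fromℕ-∸ {i} {k} i≤k = R.trans (R.reflexive (cong fromℕ (≡.sym (ℕP.m∸n+n≡m i≤k)))) (fromℕ-+ (k ∸ i) i)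

  stirlingConv-suc-0 : ∀ l → stirlingConv (suc l) 0 ≈ 0ℝ
  stirlingConv-suc-0 l = begin
    0ℝ + coeff 0 * moment (suc l) 0  ≈⟨ R.+-identityˡ _ ⟩
    coeff 0 * moment (suc l) 0       ≈⟨ R.*-congˡ (moment-suc-0 l) ⟩
    coeff 0 * 0ℝ                     ≈⟨ R.zeroʳ (coeff 0) ⟩
    0ℝ                               ∎

  -- Write [k + 1] = [j] + q^j [i] in the summands with i + j = k + 1; coeff-suc
  -- turns the contribution of q^j [i] into a multiple of the previous convolution.
  stirlingConv-suc : ∀ l k →
    [ fromℕ (suc k) ]q * stirlingConv l (suc k) + q^ (fromℕ k) * stirlingConv l k ≈ stirlingConv (suc l) (suc k)
  stirlingConv-suc l k = begin
    K * stirlingConv l (suc k) + Q * stirlingConv l k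
      ≈⟨ R.+-congʳ (*-sum K (suc (suc k)) (λ i → coeff i * moment l (suc k ∸ i))) ⟩
    sumℝ (suc (suc k)) (λ i → K * (coeff i * moment l (suc k ∸ i))) + Q * stirlingConv l k
      ≈⟨ R.+-congʳ (sum-cong (suc (suc k)) λ { i (s≤s i≤1+k) → split i i≤1+k }) ⟩
    sumℝ (suc (suc k)) (λ i → coeff i * moment (suc l) (suc k ∸ i) + z i) + Q * stirlingConv l k
      ≈⟨ R.+-congʳ (sum-+ (suc (suc k)) (λ i → coeff i * moment (suc l) (suc k ∸ i)) z) ⟩
    stirlingConv (suc l) (suc k) + sumℝ (suc (suc k)) z + Q * stirlingConv l k
      ≈⟨ R.+-assoc (stirlingConv (suc l) (suc k)) (sumℝ (suc (suc k)) z) (Q * stirlingConv l k) ⟩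
    stirlingConv (suc l) (suc k) + (sumℝ (suc (suc k)) z + Q * stirlingConv l k)
      -- `z 0` contains [0]_q = 0. The other `suc k` values of `z` then match the summands of
      -- `stirlingConv l k` one to one, with index shifted by 1.
      ≈⟨ R.+-congˡ (R.+-cong (R.trans (sum-front (suc k) z) (R.trans (R.+-congʳ z0≈0) (R.+-identityˡ _))) (*-sum Q (suc k) (λ i → coeff i * moment l (k ∸ i)))) ⟩
    stirlingConv (suc l) (suc k) + (sumℝ (suc k) (z ∘ suc) + sumℝ (suc k) (λ i → Q * (coeff i * moment l (k ∸ i))))
      ≈⟨ R.+-congˡ (sum-+ (suc k) (z ∘ suc) (λ i → Q * (coeff i * moment l (k ∸ i)))) ⟨
    stirlingConv (suc l) (suc k) + sumℝ (suc k) (λ i → z (suc i) + Q * (coeff i * moment l (k ∸ i)))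
      ≈⟨ R.+-congˡ (sum-zero (suc k) λ { i (s≤s i≤k) → cancel i i≤k }) ⟩
    stirlingConv (suc l) (suc k) + 0ℝ
      ≈⟨ R.+-identityʳ (stirlingConv (suc l) (suc k)) ⟩
    stirlingConv (suc l) (suc k) ∎
    where
    K = [ fromℕ (suc k) ]q
    Q = q^ (fromℕ k)
    z : ℕ → ℝ
    z i = q^ (fromℕ (suc k ∸ i)) * ([ fromℕ i ]q * coeff i) * moment l (suc k ∸ i)
    split : ∀ i → i ℕ.≤ suc k →
      K * (coeff i * moment l (suc k ∸ i)) ≈ coeff i * moment (suc l) (suc k ∸ i) + z i
    split i i≤1+k = begin
      K * (coeff i * g)
        ≈⟨ R.*-congʳ (R.trans ([]q-cong (fromℕ-∸ i≤1+k)) ([x+y]q (fromℕ (suc k ∸ i)) (fromℕ i))) ⟩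
      (J + G * I) * (coeff i * g)
        ≈⟨ solve 5 (λ J G I c g → (J :+ G :* I) :* (c :* g) := c :* (J :* g) :+ G :* (I :* c) :* g) R.refl J G I (coeff i) g ⟩
      coeff i * (J * g) + z i
        ≈⟨ R.+-congʳ (R.*-congˡ (moment-suc l (suc k ∸ i))) ⟨
      coeff i * moment (suc l) (suc k ∸ i) + z i ∎
      where
      J = [ fromℕ (suc k ∸ i) ]q
      G = q^ (fromℕ (suc k ∸ i))
      I = [ fromℕ i ]q
      g = moment l (suc k ∸ i)
    z0≈0 : z 0 ≈ 0ℝ
    z0≈0 = begin
      G * ([ fromℕ 0 ]q * coeff 0) * g  ≈⟨ R.*-congʳ (R.*-congˡ (R.trans (R.*-congʳ [0]q) (R.zeroˡ (coeff 0)))) ⟩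
      G * 0ℝ * g                        ≈⟨ R.trans (R.*-congʳ (R.zeroʳ G)) (R.zeroˡ g) ⟩
      0ℝ                                ∎
      where
      G = q^ (fromℕ (suc k))
      g = moment l (suc k)
    cancel : ∀ i → i ℕ.≤ k → z (suc i) + Q * (coeff i * moment l (k ∸ i)) ≈ 0ℝ
    cancel i i≤k = begin
      G * A * g + Q * (coeff i * g)
        ≈⟨ R.+-congˡ (R.*-congʳ (R.trans (q^-cong (fromℕ-∸ i≤k)) (R.sym (q^-homo (fromℕ (k ∸ i)) (fromℕ i))))) ⟩
      G * A * g + (G * I) * (coeff i * g)
        ≈⟨ solve 5 (λ G A g I c → G :* A :* g :+ (G :* I) :* (c :* g) := (G :* g) :* (A :+ I :* c)) R.refl G A g I (coeff i) ⟩
      (G * g) * (A + I * coeff i)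
        ≈⟨ R.*-congˡ (coeff-suc i) ⟩
      (G * g) * 0ℝ
        ≈⟨ R.zeroʳ (G * g) ⟩
      0ℝ ∎
      where
      G = q^ (fromℕ (k ∸ i))
      A = [ fromℕ (suc i) ]q * coeff (suc i)
      g = moment l (k ∸ i)
      I = q^ (fromℕ i)

  -- Row zero and vanishing above the diagonal.

  stirlingConv-0-0 : stirlingConv 0 0 ≈ 1ℝ
  stirlingConv-0-0 = begin
    -- The last factor is `moment 0 0`, where 0^0 = 1 enters.
    0ℝ + 1ℝ * q^ 0ℝ * e * (1ℝ * e)  ≈⟨ R.+-identityˡ _ ⟩
    1ℝ * q^ 0ℝ * e * (1ℝ * e)       ≈⟨ R.*-cong (R.*-cong (R.*-congˡ q^0) e≈1) (R.*-congˡ e≈1) ⟩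
    1ℝ * 1ℝ * 1ℝ * (1ℝ * 1ℝ)        ≈⟨ pointwise (λ _ → ≡.refl) ⟩
    1ℝ                              ∎
    where
    e = recip-q! 0
    e≈1 : e ≈ 1ℝ
    e≈1 = R.trans (R.sym (R.*-identityˡ e)) (q!-inverse 0)

  -- A factor [j]_q turns 1/[j]_q! into 1/[j-1]_q!, which shifts the convolution by one; the summand
  -- with j = 0 drops out.
  stirlingConv-1-suc : ∀ k → stirlingConv 1 (suc k) ≈ stirlingConv 0 k
  stirlingConv-1-suc k = begin
    sumℝ (suc k) (λ i → coeff i * moment 1 (suc k ∸ i)) + coeff (suc k) * moment 1 (k ∸ k)
      ≈⟨ R.+-cong (sum-cong (suc k) λ { i (s≤s i≤k) → term i i≤k }) last ⟩
    stirlingConv 0 k + 0ℝ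
      ≈⟨ R.+-identityʳ (stirlingConv 0 k) ⟩
    stirlingConv 0 k ∎
    where
    last : coeff (suc k) * moment 1 (k ∸ k) ≈ 0ℝ
    last = begin
      coeff (suc k) * moment 1 (k ∸ k)  ≡⟨ cong (λ j → coeff (suc k) * moment 1 j) (ℕP.n∸n≡0 k) ⟩
      coeff (suc k) * moment 1 0        ≈⟨ R.*-congˡ (moment-suc-0 0) ⟩
      coeff (suc k) * 0ℝ                ≈⟨ R.zeroʳ (coeff (suc k)) ⟩
      0ℝ                                ∎
    term : ∀ i → i ℕ.≤ k → coeff i * moment 1 (suc k ∸ i) ≈ coeff i * moment 0 (k ∸ i)
    term i i≤k = R.*-congˡ (begin
      moment 1 (suc k ∸ i)                                        ≡⟨ cong (moment 1) (ℕP.+-∸-assoc 1 i≤k) ⟩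
      moment 1 (suc (k ∸ i))                                      ≈⟨ moment-suc 0 (suc (k ∸ i)) ⟩
      [ fromℕ (suc (k ∸ i)) ]q * (1ℝ * recip-q! (suc (k ∸ i)))    ≈⟨ R.*-congˡ (R.*-identityˡ _) ⟩
      [ fromℕ (suc (k ∸ i)) ]q * recip-q! (suc (k ∸ i))           ≈⟨ recip-q!-suc (k ∸ i) ⟩
      recip-q! (k ∸ i)                                            ≈⟨ R.*-identityˡ (recip-q! (k ∸ i)) ⟨
      moment 0 (k ∸ i)                                            ∎)

  -- Row zero lists the coefficients of e_q(t) E_q(-t) = 1, a product of the two q-exponentials. The
  -- proof compares `stirlingConv-suc` for row 0 with `stirlingConv-1-suc`: writing V_k for row
  -- zero, [k+1]_q V_(k+1) + q^k V_k = V_k. Here q^k V_k = V_k, because q^0 = 1 if k = 0 and V_k = 0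
  -- by induction otherwise. Hence [k+1]_q V_(k+1) = 0, and [k+1]_q is positive.
  stirlingConv-0-suc : ∀ k → stirlingConv 0 (suc k) ≈ 0ℝ
  stirlingConv-0-suc k = x*y≈0⇒y≈0 (>0⇒#0 ([suc]q>0 k)) (identityˡ-unique _ _ (lem k))
    where
    open import Algebra.Properties.Group R.+-group using (identityˡ-unique)
    rec : ∀ k → [ fromℕ (suc k) ]q * stirlingConv 0 (suc k) + q^ (fromℕ k) * stirlingConv 0 k ≈ stirlingConv 0 k
    rec k = R.trans (stirlingConv-suc 0 k) (stirlingConv-1-suc k)
    lem : ∀ k → [ fromℕ (suc k) ]q * stirlingConv 0 (suc k) + stirlingConv 0 k ≈ stirlingConv 0 k
    lem zero    = R.trans (R.+-congˡ (R.sym (R.trans (R.*-congʳ q^0) (R.*-identityˡ (stirlingConv 0 0))))) (rec 0)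
    lem (suc k) = begin
      A + stirlingConv 0 (suc k)                            ≈⟨ R.+-congˡ (stirlingConv-0-suc k) ⟩
      A + 0ℝ                                                ≈⟨ R.+-congˡ (R.trans (R.*-congˡ (stirlingConv-0-suc k)) (R.zeroʳ Q)) ⟨
      A + Q * stirlingConv 0 (suc k)                        ≈⟨ rec (suc k) ⟩
      stirlingConv 0 (suc k)                                ∎
      where
      A = [ fromℕ (suc (suc k)) ]q * stirlingConv 0 (suc (suc k))
      Q = q^ (fromℕ (suc k))

  -- Induction on `l` along the recurrence, starting from row zero. The case `k = suc l` removes the
  -- boundary term in `qFalling-expansion`.
  stirlingConv-vanishes : ∀ {l k} → l ℕ.< k → stirlingConv l k ≈ 0ℝ
  stirlingConv-vanishes {zero}  {suc k} _         = stirlingConv-0-suc k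
  stirlingConv-vanishes {suc l} {suc k} (s≤s l<k) = begin
    stirlingConv (suc l) (suc k)                      ≈⟨ stirlingConv-suc l k ⟨
    K * stirlingConv l (suc k) + Q * stirlingConv l k ≈⟨ R.+-cong (R.*-congˡ (stirlingConv-vanishes (ℕP.m<n⇒m<1+n l<k))) (R.*-congˡ (stirlingConv-vanishes l<k)) ⟩
    K * 0ℝ + Q * 0ℝ                                   ≈⟨ R.+-cong (R.zeroʳ K) (R.zeroʳ Q) ⟩
    0ℝ + 0ℝ                                           ≈⟨ R.+-identityˡ 0ℝ ⟩
    0ℝ                                                ∎
    where
    K = [ fromℕ (suc k) ]q
    Q = q^ (fromℕ k)

  -- Expansion of powers of [x]_q in falling products.

  -- The addition rule applied to x = k + (x - k); the factor [x-k]_q is the one that extends the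
  -- falling product.
  qFalling-suc : ∀ x k → [ x ]q * qFalling x k ≈ [ fromℕ k ]q * qFalling x k + q^ (fromℕ k) * qFalling x (suc k)
  qFalling-suc x k = begin
    [ x ]q * F                                   ≈⟨ R.*-congʳ ([]q-cong (pointwise λ n → lem (seq x n) (ι k))) ⟩
    [ fromℕ k + (x - fromℕ k) ]q * F             ≈⟨ R.*-congʳ ([x+y]q (fromℕ k) (x - fromℕ k)) ⟩
    (K + Q * X) * F                              ≈⟨ solve 4 (λ K Q X F → (K :+ Q :* X) :* F := K :* F :+ Q :* (F :* X)) R.refl K Q X F ⟩
    K * F + Q * (F * X)                          ∎
    where
    F = qFalling x k
    K = [ fromℕ k ]q
    Q = q^ (fromℕ k)
    X = [ x - fromℕ k ]q
    lem : ∀ x k → x ≡ k ℚ.+ (x ℚ.- k)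
    lem = solve-∀ ℚ-ring

  qFalling-expansion : ∀ x l → sumℝ (suc l) (λ k → qFalling x k * stirlingConv l k) ≈ [ x ]q ^ l
  qFalling-expansion x zero = begin
    0ℝ + 1ℝ * stirlingConv 0 0  ≈⟨ R.trans (R.+-identityˡ _) (R.*-identityˡ (stirlingConv 0 0)) ⟩
    stirlingConv 0 0            ≈⟨ stirlingConv-0-0 ⟩
    1ℝ                          ∎
  qFalling-expansion x (suc l) = begin
    sumℝ (suc (suc l)) (λ k → F k * stirlingConv (suc l) k)
      ≈⟨ sum-front (suc l) (λ k → F k * stirlingConv (suc l) k) ⟩
    F 0 * stirlingConv (suc l) 0 + sumℝ (suc l) (λ k → F (suc k) * stirlingConv (suc l) (suc k))
      -- The front term and `h 0` are both zero, so `h 0` can take its place and complete the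
      -- shifted sum of `h`.
      ≈⟨ R.+-cong (R.trans (R.*-congˡ (stirlingConv-suc-0 l)) (R.trans (R.zeroʳ (F 0)) (R.sym h0≈0))) (sum-cong (suc l) λ k _ → split k) ⟩
    h 0 + sumℝ (suc l) (λ k → h (suc k) + u k)
      ≈⟨ R.+-congˡ (sum-+ (suc l) (h ∘ suc) u) ⟩
    h 0 + (sumℝ (suc l) (h ∘ suc) + sumℝ (suc l) u)
      ≈⟨ R.+-assoc (h 0) (sumℝ (suc l) (h ∘ suc)) (sumℝ (suc l) u) ⟨
    h 0 + sumℝ (suc l) (h ∘ suc) + sumℝ (suc l) u
      ≈⟨ R.+-congʳ (sum-front (suc l) h) ⟨
    sumℝ (suc l) h + h (suc l) + sumℝ (suc l) u
      -- The surplus top term contains `stirlingConv l (suc l)`, which lies above the diagonal.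
      ≈⟨ R.+-congʳ (R.trans (R.+-congˡ h[1+l]≈0) (R.+-identityʳ (sumℝ (suc l) h))) ⟩
    sumℝ (suc l) h + sumℝ (suc l) u
      ≈⟨ sum-+ (suc l) h u ⟨
    sumℝ (suc l) (λ k → h k + u k)
      ≈⟨ sum-cong (suc l) (λ k _ → merge k) ⟩
    sumℝ (suc l) (λ k → [ x ]q * (F k * stirlingConv l k))
      ≈⟨ *-sum [ x ]q (suc l) (λ k → F k * stirlingConv l k) ⟨
    [ x ]q * sumℝ (suc l) (λ k → F k * stirlingConv l k)
      ≈⟨ R.*-congˡ (qFalling-expansion x l) ⟩
    [ x ]q * [ x ]q ^ l ∎
    where
    F = qFalling x
    h u : ℕ → ℝ
    h k = [ fromℕ k ]q * F k * stirlingConv l k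
    u k = q^ (fromℕ k) * F (suc k) * stirlingConv l k
    h0≈0 : h 0 ≈ 0ℝ
    h0≈0 = begin
      [ fromℕ 0 ]q * F 0 * stirlingConv l 0  ≈⟨ R.*-congʳ (R.trans (R.*-congʳ [0]q) (R.zeroˡ (F 0))) ⟩
      0ℝ * stirlingConv l 0                  ≈⟨ R.zeroˡ (stirlingConv l 0) ⟩
      0ℝ                                     ∎
    h[1+l]≈0 : h (suc l) ≈ 0ℝ
    h[1+l]≈0 = R.trans (R.*-congˡ (stirlingConv-vanishes (ℕP.n<1+n l))) (R.zeroʳ _)
    split : ∀ k → F (suc k) * stirlingConv (suc l) (suc k) ≈ h (suc k) + u k
    split k = R.trans (R.*-congˡ (R.sym (stirlingConv-suc l k)))
      (solve 5 (λ F K V Q W → F :* (K :* V :+ Q :* W) := K :* F :* V :+ Q :* F :* W) R.refl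
        (F (suc k)) [ fromℕ (suc k) ]q (stirlingConv l (suc k)) (q^ (fromℕ k)) (stirlingConv l k))
    merge : ∀ k → h k + u k ≈ [ x ]q * (F k * stirlingConv l k)
    merge k = begin
      h k + u k                                                             ≈⟨ R.distribʳ (stirlingConv l k) _ _ ⟨
      ([ fromℕ k ]q * F k + q^ (fromℕ k) * F (suc k)) * stirlingConv l k    ≈⟨ R.*-congʳ (qFalling-suc x k) ⟨
      [ x ]q * F k * stirlingConv l k                                       ≈⟨ R.*-assoc [ x ]q (F k) (stirlingConv l k) ⟩
      [ x ]q * (F k * stirlingConv l k)                                     ∎

  -- Evaluation of the Stirling side.

  q^-inverse : ∀ x → q^ x * q^ (- x) ≈ 1ℝ
  q^-inverse x = R.trans (q^-homo x (- x)) (R.trans (q^-cong (R.-‿inverseʳ x)) q^0)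

  -- The powers of q with exponents C(k,2) and -C(k,2) cancel, as do [k]_q! and the denominator of
  -- the q-binomial coefficient.
  qBinomial*qStirling : ∀ x l k →
    q^ (fromℕ (k C 2)) * qBinomial x k * [ k ]q! * qStirling l k ≈ qFalling x k * stirlingConv l k
  qBinomial*qStirling x l k = begin
    Q * (F * e) * [ k ]q! * qStirling l k     ≈⟨ R.*-congˡ (qStirling≈ l k) ⟩
    Q * (F * e) * [ k ]q! * (Q⁻¹ * W)         ≈⟨ solve 6 (λ Q F e K Q⁻¹ W → Q :* (F :* e) :* K :* (Q⁻¹ :* W) := (Q :* Q⁻¹) :* ((K :* e) :* (F :* W))) R.refl Q F e [ k ]q! Q⁻¹ W ⟩
    (Q * Q⁻¹) * (([ k ]q! * e) * (F * W))     ≈⟨ R.*-cong (q^-inverse (fromℕ (k C 2))) (R.*-congʳ (q!-inverse k)) ⟩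
    1ℝ * (1ℝ * (F * W))                       ≈⟨ R.trans (R.*-identityˡ _) (R.*-identityˡ (F * W)) ⟩
    F * W                                     ∎
    where
    Q = q^ (fromℕ (k C 2))
    Q⁻¹ = q^ (- fromℕ (k C 2))
    F = qFalling x k
    e = recip-q! k
    W = stirlingConv l k

  -- Splitting the exponent of q separates each summand into a factor in `k` and a factor in `j`, so
  -- the double sum is a product of two expansions.
  qStirling-double-sum : ∀ l x y →
    (Σ[ k ∈ 0 ⋯ l ] Σ[ j ∈ 0 ⋯ l ]
      q^ (fromℕ (k C 2 ℕ.+ j C 2)) * qBinomial x k * qBinomial y j
        * [ k ]q! * [ j ]q! * qStirling l k * qStirling l j)
    ≈ [ x ]q ^ l * [ y ]q ^ l
  qStirling-double-sum l x y = begin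
    _ ≈⟨ sum-cong (suc l) (λ k _ → sum-cong (suc l) λ j _ → term k j) ⟩
    sumℝ (suc l) (λ k → sumℝ (suc l) (λ j → (qFalling x k * stirlingConv l k) * (qFalling y j * stirlingConv l j)))
      ≈⟨ sum-product (suc l) (suc l) (λ k → qFalling x k * stirlingConv l k) (λ j → qFalling y j * stirlingConv l j) ⟩
    sumℝ (suc l) (λ k → qFalling x k * stirlingConv l k) * sumℝ (suc l) (λ j → qFalling y j * stirlingConv l j)
      ≈⟨ R.*-cong (qFalling-expansion x l) (qFalling-expansion y l) ⟩
    [ x ]q ^ l * [ y ]q ^ l ∎
    where
    term : ∀ k j →
      q^ (fromℕ (k C 2 ℕ.+ j C 2)) * qBinomial x k * qBinomial y j * [ k ]q! * [ j ]q! * qStirling l k * qStirling l j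
      ≈ (qFalling x k * stirlingConv l k) * (qFalling y j * stirlingConv l j)
    term k j = begin
      q^ (fromℕ (k C 2 ℕ.+ j C 2)) * qBinomial x k * qBinomial y j * [ k ]q! * [ j ]q! * qStirling l k * qStirling l j
        ≈⟨ R.*-congʳ (R.*-congʳ (R.*-congʳ (R.*-congʳ (R.*-congʳ (R.*-congʳ
             (R.trans (q^-cong (fromℕ-+ (k C 2) (j C 2))) (R.sym (q^-homo (fromℕ (k C 2)) (fromℕ (j C 2)))))))))) ⟩
      (q^ (fromℕ (k C 2)) * q^ (fromℕ (j C 2))) * qBinomial x k * qBinomial y j * [ k ]q! * [ j ]q! * qStirling l k * qStirling l j
        ≈⟨ solve 8 (λ P Q A B K J S T → (P :* Q) :* A :* B :* K :* J :* S :* T := (P :* A :* K :* S) :* (Q :* B :* J :* T)) R.refl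
             (q^ (fromℕ (k C 2))) (q^ (fromℕ (j C 2))) (qBinomial x k) (qBinomial y j) [ k ]q! [ j ]q! (qStirling l k) (qStirling l j) ⟩
      (q^ (fromℕ (k C 2)) * qBinomial x k * [ k ]q! * qStirling l k) * (q^ (fromℕ (j C 2)) * qBinomial y j * [ j ]q! * qStirling l j)
        ≈⟨ R.*-cong (qBinomial*qStirling x l k) (qBinomial*qStirling y l j) ⟩
      (qFalling x k * stirlingConv l k) * (qFalling y j * stirlingConv l j) ∎

  -- Evaluation of the Bernstein side.

  -- An inductive family instead of an equation, so that the with-abstraction in
  -- qBernstein-inside does not normalise the product (this would unfold the
  -- positivity proofs inside [_]q).
  data BernsteinProduct (k j n m : ℕ) (x y : ℝ) : ℝ → Set where
    product : BernsteinProduct k j n m x y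
      (fromℕ (n C k) * fromℕ (m C j) * [ x ]q ^ k * [ y ]q ^ j * [ 1ℝ - x ]q ^ (n ∸ k) * [ 1ℝ - y ]q ^ (m ∸ j))

  qBernstein-inside : ∀ {k j n m} x y → k ℕ.≤ n → j ℕ.≤ m →
    BernsteinProduct k j n m x y (qBernstein (+ k) (+ j) (+ n) (+ m) x y)
  qBernstein-inside {k} {j} {n} {m} x y k≤n j≤m with (k ℕP.≤? n) ×-dec (j ℕP.≤? m)
  ... | yes _ = product
  ... | no  h = ⊥-elim (h (k≤n , j≤m))

  BernsteinProduct⇒≈ : ∀ {k j n m x y z} → BernsteinProduct k j n m x y z →
    z ≈ fromℕ (n C k) * fromℕ (m C j) * [ x ]q ^ k * [ y ]q ^ j * [ 1ℝ - x ]q ^ (n ∸ k) * [ 1ℝ - y ]q ^ (m ∸ j)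
  BernsteinProduct⇒≈ product = R.refl

  qBernstein-double-sum : ∀ {n m l} (l≤n : l ℕ.≤ n) (l≤m : l ℕ.≤ m) x y →
    (Σ[ k ∈ l ⋯ n ] Σ[ j ∈ l ⋯ m ]
      (fromℕ (k C l) * fromℕ (j C l)) ÷ (fromℕ (n C l) * fromℕ (m C l)) [ binomials#0 l≤n l≤m ]
        * qBernstein (+ k) (+ j) (+ n) (+ m) x y)
    ≈ ([ x ]q ^ l * ([ x ]q + [ 1ℝ - x ]q) ^ (n ∸ l)) * ([ y ]q ^ l * ([ y ]q + [ 1ℝ - y ]q) ^ (m ∸ l))
  qBernstein-double-sum {n} {m} {l} l≤n l≤m x y = begin
    -- The summation ranges force `k ≤ n` and `j ≤ m`, so the default value 0 of `qBernstein` never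
    -- occurs.
    _ ≈⟨ sum-cong (suc n ∸ l) (λ i i< → sum-cong (suc m ∸ l) λ j j< → term (l ℕ.+ i) (l ℕ.+ j) (i<1+n∸l⇒l+i≤n l≤n i<) (i<1+n∸l⇒l+i≤n l≤m j<)) ⟩
    sumℝ (suc n ∸ l) (λ i → sumℝ (suc m ∸ l) (λ j → (r * u (l ℕ.+ i)) * v (l ℕ.+ j)))
      ≈⟨ sum-product (suc n ∸ l) (suc m ∸ l) (λ i → r * u (l ℕ.+ i)) (λ j → v (l ℕ.+ j)) ⟩
    sumℝ (suc n ∸ l) (λ i → r * u (l ℕ.+ i)) * sumℝ (suc m ∸ l) (λ j → v (l ℕ.+ j))
      ≈⟨ R.*-cong (R.trans (R.sym (*-sum r (suc n ∸ l) (λ i → u (l ℕ.+ i)))) (R.*-congˡ (bernstein-sum l≤n [ x ]q [ 1ℝ - x ]q)))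
                  (bernstein-sum l≤m [ y ]q [ 1ℝ - y ]q) ⟩
    (r * (fromℕ (n C l) * U)) * (fromℕ (m C l) * V)
      -- The constants C(n,l) and C(m,l) from the two Bernstein sums are collected to meet their
      -- joint reciprocal `r`.
      ≈⟨ solve 5 (λ r a U b V → (r :* (a :* U)) :* (b :* V) := ((a :* b) :* r) :* (U :* V)) R.refl r (fromℕ (n C l)) U (fromℕ (m C l)) V ⟩
    ((fromℕ (n C l) * fromℕ (m C l)) * r) * (U * V)
      ≈⟨ R.*-congʳ (recip-inverse (fromℕ (n C l) * fromℕ (m C l)) (binomials#0 l≤n l≤m)) ⟩
    1ℝ * (U * V)
      ≈⟨ R.*-identityˡ (U * V) ⟩
    U * V ∎
    where
    r = recip (fromℕ (n C l) * fromℕ (m C l)) (binomials#0 l≤n l≤m)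
    U = [ x ]q ^ l * ([ x ]q + [ 1ℝ - x ]q) ^ (n ∸ l)
    V = [ y ]q ^ l * ([ y ]q + [ 1ℝ - y ]q) ^ (m ∸ l)
    u v : ℕ → ℝ
    u k = fromℕ (k C l) * (fromℕ (n C k) * ([ x ]q ^ k * [ 1ℝ - x ]q ^ (n ∸ k)))
    v j = fromℕ (j C l) * (fromℕ (m C j) * ([ y ]q ^ j * [ 1ℝ - y ]q ^ (m ∸ j)))
    term : ∀ k j → k ℕ.≤ n → j ℕ.≤ m →
      (fromℕ (k C l) * fromℕ (j C l)) * r * qBernstein (+ k) (+ j) (+ n) (+ m) x y ≈ (r * u k) * v j
    term k j k≤n j≤m = R.trans (R.*-congˡ (BernsteinProduct⇒≈ (qBernstein-inside x y k≤n j≤m)))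
      (solve 9 (λ a b r c d X Y X′ Y′ →
          (a :* b) :* r :* (c :* d :* X :* Y :* X′ :* Y′) := (r :* (a :* (c :* (X :* X′)))) :* (b :* (d :* (Y :* Y′)))) R.refl
        (fromℕ (k C l)) (fromℕ (j C l)) r (fromℕ (n C k)) (fromℕ (m C j))
        ([ x ]q ^ k) ([ y ]q ^ j) ([ 1ℝ - x ]q ^ (n ∸ k)) ([ 1ℝ - y ]q ^ (m ∸ j)))

-- Comparison of both sides through [x]_q^l [y]_q^l.

theorem11 : (q : ℝ) (0<q : 0ℝ < q) (q<1 : q < 1ℝ) →
    let open q-Calculus q 0<q q<1 in
    (n m l : ℕ) (l≤n : l ℕ.≤ n) (l≤m : l ℕ.≤ m)
    (x y : ℝ) (0≤x : 0ℝ ≤ x) (x≤1 : x ≤ 1ℝ) (0≤y : 0ℝ ≤ y) (y≤1 : y ≤ 1ℝ) →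
    1ℝ ÷ (([ x ]q + [ 1ℝ - x ]q) ^ (n ∸ l) * ([ y ]q + [ 1ℝ - y ]q) ^ (m ∸ l))
      [ denominator#0 0≤x x≤1 0≤y y≤1 (n ∸ l) (m ∸ l) ]
    * (Σ[ k ∈ l ⋯ n ] Σ[ j ∈ l ⋯ m ]
        (fromℕ (k C l) * fromℕ (j C l)) ÷ (fromℕ (n C l) * fromℕ (m C l)) [ binomials#0 l≤n l≤m ]
          * qBernstein (+ k) (+ j) (+ n) (+ m) x y)
    ≈ (Σ[ k ∈ 0 ⋯ l ] Σ[ j ∈ 0 ⋯ l ]
        q^ (fromℕ (k C 2 ℕ.+ j C 2)) * qBinomial x k * qBinomial y j
          * [ k ]q! * [ j ]q! * qStirling l k * qStirling l j)
theorem11 q 0<q q<1 n m l l≤n l≤m x y 0≤x x≤1 0≤y y≤1 = begin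
  1ℝ * r * _                           ≈⟨ R.*-congˡ (qBernstein-double-sum q 0<q q<1 l≤n l≤m x y) ⟩
  1ℝ * r * ((X * S) * (Y * T))         ≈⟨ R.*-congʳ (R.*-identityˡ r) ⟩
  r * ((X * S) * (Y * T))              ≈⟨ solve 5 (λ r X S Y T → r :* ((X :* S) :* (Y :* T)) := ((S :* T) :* r) :* (X :* Y)) R.refl r X S Y T ⟩
  -- `S * T` is exactly the denominator, so the powers left by the binomial theorem cancel.
  ((S * T) * r) * (X * Y)              ≈⟨ R.*-congʳ (recip-inverse (S * T) (denominator#0 0≤x x≤1 0≤y y≤1 (n ∸ l) (m ∸ l))) ⟩
  1ℝ * (X * Y)                         ≈⟨ R.*-identityˡ (X * Y) ⟩
  X * Y                                ≈⟨ qStirling-double-sum q 0<q q<1 l x y ⟨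
  _                                    ∎
  where
  open q-Calculus q 0<q q<1
  S = ([ x ]q + [ 1ℝ - x ]q) ^ (n ∸ l)
  T = ([ y ]q + [ 1ℝ - y ]q) ^ (m ∸ l)
  X = [ x ]q ^ l
  Y = [ y ]q ^ l
  r = recip (S * T) (denominator#0 0≤x x≤1 0≤y y≤1 (n ∸ l) (m ∸ l))
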